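{- For integers $n,j\ge 0$, let $p_{od,e}(n,j)$ be the number of partitions $\lambda$ of $n$ in which no odd part is repeated and which have exactly $j$ even parts (counted with multiplicity) greater than $\mathrm{meex}(\lambda)$. Let $p_{4,e}(n,j)$ be the number of partitions of $n$ in which every even part is a multiple of $4$ and which have exactly $j$ even parts (counted with multiplicity). Then $p_{od,e}(n,j)=p_{4,e}(n,j)$.
   Context: For a partition $\lambda$, $\mathrm{meex}(\lambda)$ is the smallest positive even integer that is not a part of $\lambda$. In partitions in which no odd part is repeated, even parts may appear with any multiplicity. In the partitions counted by $p_{4,e}(n,j)$, odd parts are unrestricted and may be repeated. -}

module Defs where

open import Data.Bool.Base using (true; false; if_then_else_)
open import Data.List.Base using (List; []; _∷_; _++_; map; filter; length)
open import Data.List.Membership.Propositional using (_∈_; _∉_)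
open import Data.List.Membership.Propositional.Properties using (∈-map⁺; ∈-map⁻; ∈-++⁺ˡ; ∈-++⁺ʳ; ∈-++⁻)
open import Data.List.Membership.DecPropositional using () renaming (_∈?_ to mem?)
open import Data.List.Properties using (∷-injectiveʳ)
open import Data.List.Relation.Binary.Disjoint.Propositional using (Disjoint)
open import Data.List.Relation.Unary.All as All using (All; []; _∷_)
open import Data.List.Relation.Unary.AllPairs using (AllPairs; []; _∷_; allPairs?)
open import Data.List.Relation.Unary.Any using (here; there)
open import Data.List.Relation.Unary.Unique.Propositional using (Unique)
open import Data.List.Relation.Unary.Unique.Propositional.Properties using (map⁺; ++⁺)
open import Data.Nat.Base using (ℕ; zero; suc; _+_; _∸_; _≤_; _<_; _≥_; _≤ᵇ_; z≤n; s≤s)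
open import Data.Nat.Divisibility using (_∣_; _∣?_; ∣-refl; ∣m∣n⇒∣m+n; ∣m+n∣m⇒∣n; ∣1⇒≡1; _∣0)
open import Data.Nat.ListAction using (sum)
open import Data.Nat.Properties
open import Data.Product.Base using (_×_; _,_; proj₁; proj₂)
open import Data.Sum.Base using (inj₁; inj₂)
open import Function.Base using (_∘_)
open import Function.Bundles using (_⇔_; mk⇔)
open import Relation.Binary.PropositionalEquality using (_≡_; refl; sym; trans; cong; subst)
open import Relation.Nullary using (¬_; does; yes; no; ofʸ; ofⁿ; ¬?; contradiction)
open import Relation.Nullary.Decidable using (_×-dec_; _→-dec_)
open import Relation.Unary using (Decidable)

record IsPartition (n : ℕ) (π : List ℕ) : Set where
  constructor isPartition
  field
    decreasing : AllPairs _≥_ π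
    positive   : All (0 <_) π
    total      : sum π ≡ n

-- The partitions of n with at most l parts, each part at most m.
boundedPartitions : (l m n : ℕ) → List (List ℕ)
boundedPartitions l       m       zero    = [] ∷ []
boundedPartitions zero    m       (suc n) = []
boundedPartitions (suc l) zero    (suc n) = []
boundedPartitions (suc l) (suc m) (suc n) =
  boundedPartitions (suc l) m (suc n) ++
  (if m ≤ᵇ n
   then map (suc m ∷_) (boundedPartitions l (suc m) (n ∸ m))
   else [])

-- See partitions-correct and partitions-unique below: each partition of n
-- occurs in this list, exactly once, and nothing else does.
partitions : ℕ → List (List ℕ)
partitions n = boundedPartitions n n n

numberOfPartitions : (n : ℕ) {P : List ℕ → Set} → Decidable P → ℕ
numberOfPartitions n P? = length (filter P? (partitions n))

Even Odd : ℕ → Set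
Even k = 2 ∣ k
Odd  k = ¬ Even k

even? : Decidable Even
even? k = 2 ∣? k

odd? : Decidable Odd
odd? k = ¬? (even? k)

meexFrom : (fuel m : ℕ) → List ℕ → ℕ
meexFrom zero       m π = m
meexFrom (suc fuel) m π =
  if does (mem? _≟_ m π) then meexFrom fuel (2 + m) π else m

-- No part exceeds sum π, so sum π steps suffice (see meex-correct).
meex : List ℕ → ℕ
meex π = meexFrom (sum π) 2 π

record IsMeex (π : List ℕ) (m : ℕ) : Set where
  field
    positive : 0 < m
    even     : Even m
    missing  : m ∉ π
    least    : ∀ k → 0 < k → Even k → k ∉ π → m ≤ k

NoOddPartRepeated : List ℕ → Set
NoOddPartRepeated π = Unique (filter odd? π)

evenPartsAboveMeex : List ℕ → ℕ
evenPartsAboveMeex π = length (filter (λ k → even? k ×-dec (meex π <? k)) π)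

EvenPartsMultiplesOf4 : List ℕ → Set
EvenPartsMultiplesOf4 π = All (λ k → Even k → 4 ∣ k) π

evenParts : List ℕ → ℕ
evenParts π = length (filter even? π)

noOddPartRepeated? : Decidable NoOddPartRepeated
noOddPartRepeated? π = allPairs? (λ x y → ¬? (x ≟ y)) (filter odd? π)

evenPartsMultiplesOf4? : Decidable EvenPartsMultiplesOf4
evenPartsMultiplesOf4? = All.all? (λ k → even? k →-dec (4 ∣? k))

p-od,e : (n j : ℕ) → ℕ
p-od,e n j = numberOfPartitions n
  (λ π → noOddPartRepeated? π ×-dec (evenPartsAboveMeex π ≟ j))

p-4,e : (n j : ℕ) → ℕ
p-4,e n j = numberOfPartitions n
  (λ π → evenPartsMultiplesOf4? π ×-dec (evenParts π ≟ j))

∈⇒≤sum : ∀ {k} {π} → k ∈ π → k ≤ sum π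
∈⇒≤sum {π = x ∷ π} (here refl) = m≤m+n x (sum π)
∈⇒≤sum {π = x ∷ π} (there k∈π) = ≤-trans (∈⇒≤sum k∈π) (m≤n+m (sum π) x)

length≤sum : ∀ {π} → All (0 <_) π → length π ≤ sum π
length≤sum []           = z≤n
length≤sum (0<x ∷ 0<xs) = +-mono-≤ 0<x (length≤sum 0<xs)

boundedPartitions-sound : ∀ l m n {π} → π ∈ boundedPartitions l m n →
                          IsPartition n π × All (_≤ m) π
boundedPartitions-sound l m zero (here refl) = isPartition [] [] refl , []
boundedPartitions-sound (suc l) (suc m) (suc n) π∈
  with m ≤ᵇ n | ≤ᵇ-reflects-≤ m n | ∈-++⁻ (boundedPartitions (suc l) m (suc n)) π∈
... | _ | _ | inj₁ π∈ˡ =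
  let p , ≤m = boundedPartitions-sound (suc l) m (suc n) π∈ˡ
  in p , All.map m≤n⇒m≤1+n ≤m
... | true | ofʸ m≤n | inj₂ π∈ʳ with ∈-map⁻ (suc m ∷_) π∈ʳ
...   | ρ , ρ∈ , refl =
  let isPartition dec pos tot , ≤m = boundedPartitions-sound l (suc m) (n ∸ m) ρ∈
  in isPartition (≤m ∷ dec) (s≤s z≤n ∷ pos)
       (cong suc (trans (cong (m +_) tot) (m+[n∸m]≡n m≤n)))
   , ≤-refl ∷ ≤m

boundedPartitions-complete : ∀ l m n {π} → IsPartition n π →
                             length π ≤ l → All (_≤ m) π →
                             π ∈ boundedPartitions l m n
boundedPartitions-complete l m zero {[]} p _ _ = here refl
boundedPartitions-complete l m zero {suc x ∷ π} (isPartition _ _ ()) _ _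
boundedPartitions-complete l m zero {zero ∷ π} (isPartition _ (() ∷ _) _) _ _
boundedPartitions-complete l m (suc n) {[]} (isPartition _ _ ()) _ _
boundedPartitions-complete (suc l) zero (suc n) {zero ∷ π} (isPartition _ (() ∷ _) _) _ _
boundedPartitions-complete (suc l) zero (suc n) {suc x ∷ π} _ _ (() ∷ _)
boundedPartitions-complete (suc l) (suc m) (suc n) {x ∷ π}
  p@(isPartition (x≥ ∷ dec) (_ ∷ pos) tot) (s≤s len) (x≤ ∷ _)
  with x ≟ suc m
... | no x≢ = ∈-++⁺ˡ (boundedPartitions-complete (suc l) m (suc n) p (s≤s len)
                (x≤m ∷ All.map (λ y≤x → ≤-trans y≤x x≤m) x≥))
  where x≤m = m<1+n⇒m≤n (≤∧≢⇒< x≤ x≢)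
... | yes refl with m ≤ᵇ n | ≤ᵇ-reflects-≤ m n
...   | true  | ofʸ m≤n = ∈-++⁺ʳ (boundedPartitions (suc l) m (suc n))
                    (∈-map⁺ (suc m ∷_)
                      (boundedPartitions-complete l (suc m) (n ∸ m)
                        (isPartition dec pos
                          (sym (trans (cong (_∸ m) (sym (suc-injective tot))) (m+n∸m≡n m (sum π)))))
                        len x≥))
...   | false | ofⁿ m≰n = contradiction
                   (subst (m ≤_) (suc-injective tot) (m≤m+n m (sum π))) m≰n

boundedPartitions-unique : ∀ l m n → Unique (boundedPartitions l m n)
boundedPartitions-unique l       m       zero    = [] ∷ []
boundedPartitions-unique zero    m       (suc n) = []
boundedPartitions-unique (suc l) zero    (suc n) = []
boundedPartitions-unique (suc l) (suc m) (suc n) with m ≤ᵇ n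
... | false = ++⁺ (boundedPartitions-unique (suc l) m (suc n)) [] λ { (_ , ()) }
... | true  = ++⁺ (boundedPartitions-unique (suc l) m (suc n))
                  (map⁺ ∷-injectiveʳ (boundedPartitions-unique l (suc m) (n ∸ m)))
                  disjoint
  where
  disjoint : Disjoint (boundedPartitions (suc l) m (suc n))
                      (map (suc m ∷_) (boundedPartitions l (suc m) (n ∸ m)))
  disjoint (π∈ˡ , π∈ʳ) with ∈-map⁻ (suc m ∷_) π∈ʳ
  ... | _ , _ , refl =
    1+n≰n (All.head (proj₂ (boundedPartitions-sound (suc l) m (suc n) π∈ˡ)))

partitions-correct : ∀ n π → π ∈ partitions n ⇔ IsPartition n π
partitions-correct n π = mk⇔ (proj₁ ∘ boundedPartitions-sound n n n) complete
  where
  complete : IsPartition n π → π ∈ partitions n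
  complete p@(isPartition _ pos refl) =
    boundedPartitions-complete n n n p (length≤sum pos) (All.tabulate ∈⇒≤sum)

partitions-unique : ∀ n → Unique (partitions n)
partitions-unique n = boundedPartitions-unique n n n

even-gap : ∀ {m k} → Even m → Even k → m < k → 2 + m ≤ k
even-gap {m} em ek m<k = ≤∧≢⇒< m<k λ { refl →
  contradiction (∣1⇒≡1 (∣m+n∣m⇒∣n (subst Even (+-comm 1 m) ek) em)) λ () }

meexFrom-correct : ∀ fuel m π → 0 < m → Even m → sum π < fuel + m →
                   (∀ k → 0 < k → Even k → k ∉ π → m ≤ k) →
                   IsMeex π (meexFrom fuel m π)
meexFrom-correct zero m π 0<m em bound low = record
  { positive = 0<m ; even = em ; least = low
  ; missing = λ m∈π → <⇒≱ bound (∈⇒≤sum m∈π) }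
meexFrom-correct (suc fuel) m π 0<m em bound low with mem? _≟_ m π
... | no m∉π = record { positive = 0<m ; even = em ; missing = m∉π ; least = low }
... | yes m∈π = meexFrom-correct fuel (2 + m) π (s≤s z≤n) (∣m∣n⇒∣m+n ∣-refl em)
  (≤-trans bound (≤-trans (≤-reflexive (sym (+-suc fuel m))) (+-monoʳ-≤ fuel (n≤1+n (suc m)))))
  λ k 0<k ek k∉π → even-gap em ek
    (≤∧≢⇒< (low k 0<k ek k∉π) λ { refl → k∉π m∈π })

meex-correct : ∀ π → IsMeex π (meex π)
meex-correct π = meexFrom-correct (sum π) 2 π (s≤s z≤n) ∣-refl
  (m<m+n (sum π) (s≤s z≤n))
  λ k 0<k ek _ → even-gap (2 ∣0) ek 0<k

{-# OPTIONS --safe #-}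

-- Let Q = q². Sorting the partitions counted by p-od,e by their meex 2k + 2 gives the generating
-- function C(q) F(z), where C(q) = ∏ (1 + q^(2i+1)) and
--   F(w) = ∑ₖ tₖ / ∏_{i ≥ k+2} (1 - w Qⁱ),   tₖ = Q^(k(k+1)/2) / ((1 - Q) ⋯ (1 - Qᵏ)).
-- A telescoping sum shows (1 - w Q²) F(w) = F(w Q²), so F(w) = F(0) / ∏ (1 - w Q^(2i+2)), which is
-- a form of Lebesgue's identity; and F(0) = ∑ₖ tₖ = ∏ (1 + Qⁱ) by Euler. Finally
-- C(q) ∏ (1 + q^(2i)) = ∏ (1 + qⁱ) = ∏ 1/(1 - q^(2i+1)), again by Euler, and the product
-- ∏ 1/(1 - q^(2i+1)) · ∏ 1/(1 - z q^(4i+4)) is the generating function of p-4,e.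
--
-- To compare the coefficients of qⁿ it suffices to work modulo q^(n+1). There q is nilpotent, so
-- every infinite product is finite, and 1/(1 - x) is the finite sum γ x, characterised without
-- subtraction by γ x = 1 + x γ x; hence coefficients in ℕ are enough.
module Submission where

open import Defs
open import Algebra.Bundles using (CommutativeMonoid; CommutativeSemiring)
open import Algebra.Structures.Biased using (isCommutativeSemiringˡ)
open import Data.Bool.Base using (true; false; if_then_else_)
open import Data.List.Base using (List; []; _∷_; _++_; map; filter; length)
open import Data.List.Membership.Propositional using (_∈_; _∉_)
open import Data.List.Properties using (++-identityʳ; filter-accept; filter-reject)
open import Data.List.Relation.Unary.All as All using (All; []; _∷_)
open import Data.List.Relation.Unary.All.Properties using (filter⁺)
open import Data.List.Relation.Unary.AllPairs as AllPairs using (AllPairs; []; _∷_)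
open import Data.List.Relation.Unary.Any using (here; there)
open import Data.Nat.Base as ℕ using (ℕ; zero; suc; _≤_; z≤n; s≤s; _≤ᵇ_)
open import Data.Nat.Divisibility using (_∣_; divides; ∣-refl; ∣-trans; ∣m∣n⇒∣m+n; ∣m+n∣m⇒∣n; ∣1⇒≡1)
import Data.Nat.Properties as ℕ
open import Data.List.Membership.DecPropositional ℕ._≟_ using (_∈?_)
open import Data.Product.Base as Product using (_×_; _,_; ∃; proj₁; proj₂)
open import Data.Sum.Base using (inj₁; inj₂)
open import Data.Unit.Base using (⊤; tt)
open import Function.Base using (_∘_)
open import Function.Bundles using (_⇔_; mk⇔; Equivalence)
open import Level using (Level)
open import Relation.Binary.PropositionalEquality as ≡ using (_≡_; _≢_)
open import Relation.Binary.Structures using (IsEquivalence)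
open import Relation.Nullary using (¬_; ¬?; Dec; yes; no; Reflects; ofʸ; ofⁿ; contradiction)
open import Relation.Nullary.Decidable using (_×-dec_)
open import Relation.Unary using (Decidable)

-- Iterated sums and products in a commutative monoid

module BigOperator {c ℓ : Level} (M : CommutativeMonoid c ℓ) where

  open CommutativeMonoid M
  open import Relation.Binary.Reasoning.Setoid setoid
  open import Algebra.Properties.CommutativeSemigroup commutativeSemigroup using (interchange)

  big : ℕ → (ℕ → Carrier) → Carrier
  big zero    f = ε
  big (suc n) f = big n f ∙ f n

  big-cong : ∀ n {f g} → (∀ i → i ℕ.< n → f i ≈ g i) → big n f ≈ big n g
  big-cong zero    eq = refl
  big-cong (suc n) eq = ∙-cong (big-cong n λ i i<n → eq i (ℕ.m<n⇒m<1+n i<n)) (eq n ℕ.≤-refl)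

  big-ε : ∀ n {f} → (∀ i → i ℕ.< n → f i ≈ ε) → big n f ≈ ε
  big-ε zero    eq = refl
  big-ε (suc n) eq = trans
    (∙-cong (big-ε n λ i i<n → eq i (ℕ.m<n⇒m<1+n i<n)) (eq n ℕ.≤-refl)) (identityˡ ε)

  big-∙ : ∀ n {f g} → big n (λ i → f i ∙ g i) ≈ big n f ∙ big n g
  big-∙ zero    = sym (identityˡ ε)
  big-∙ (suc n) = trans (∙-congʳ (big-∙ n)) (interchange _ _ _ _)

  big-first : ∀ n f → big (suc n) f ≈ f 0 ∙ big n (f ∘ suc)
  big-first zero    f = comm _ _
  big-first (suc n) f = trans (∙-congʳ (big-first n f)) (assoc _ _ _)

  big-+ : ∀ m n f → big (m ℕ.+ n) f ≈ big m f ∙ big n (λ i → f (m ℕ.+ i))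
  big-+ m zero    f rewrite ℕ.+-identityʳ m = sym (identityʳ _)
  big-+ m (suc n) f rewrite ℕ.+-suc m n = trans (∙-congʳ (big-+ m n f)) (assoc _ _ _)

  big-truncate : ∀ {m n} f → m ≤ n → (∀ i → m ≤ i → f i ≈ ε) → big n f ≈ big m f
  big-truncate {m} {n} f m≤n eq = begin
    big n f                                             ≡⟨ ≡.cong (λ k → big k f) (ℕ.m+[n∸m]≡n m≤n) ⟨
    big (m ℕ.+ (n ℕ.∸ m)) f                             ≈⟨ big-+ m (n ℕ.∸ m) f ⟩
    big m f ∙ big (n ℕ.∸ m) (λ i → f (m ℕ.+ i))         ≈⟨ ∙-congˡ (big-ε (n ℕ.∸ m) λ i _ → eq (m ℕ.+ i) (ℕ.m≤m+n m i)) ⟩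
    big m f ∙ ε                                         ≈⟨ identityʳ _ ⟩
    big m f                                             ∎

  big-double : ∀ n f → big (n ℕ.* 2) f ≈ big n (λ i → f (i ℕ.* 2) ∙ f (suc (i ℕ.* 2)))
  big-double zero    f = refl
  big-double (suc n) f = trans (assoc _ _ _) (∙-congʳ (big-double n f))

-- Truncated power series

-- Power series over R, compared only in the coefficients of degree at most N:
-- this is the semiring R[X]/(X^(N+1)).
module Series {c ℓ : Level} (R : CommutativeSemiring c ℓ) (N : ℕ) where

  open CommutativeSemiring R
  open import Relation.Binary.Reasoning.Setoid setoid
  open import Algebra.Properties.CommutativeSemigroup +-commutativeSemigroup using (interchange)

  Coefficients : Set c
  Coefficients = ℕ → Carrier

  infix  4 _≋_
  infixl 6 _⊕_
  infixl 7 _⊛_ _·_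

  _≋_ : Coefficients → Coefficients → Set ℓ
  f ≋ g = ∀ n → n ≤ N → f n ≈ g n

  -- `_⊛_` is the Cauchy product, computed by splitting off the constant coefficient of the left
  -- factor: `f` is `f 0` plus `X` times `f ∘ suc`.
  _⊕_ _⊛_ : Coefficients → Coefficients → Coefficients
  (f ⊕ g) n = f n + g n
  (f ⊛ g) zero    = f 0 * g 0
  (f ⊛ g) (suc n) = f 0 * g (suc n) + ((f ∘ suc) ⊛ g) n

  _·_ : Carrier → Coefficients → Coefficients
  (a · f) n = a * f n

  𝟘 : Coefficients
  𝟘 _ = 0#

  const : Carrier → Coefficients
  const a zero    = a
  const a (suc _) = 0#

  X : Coefficients
  X zero    = 0#
  X (suc n) = const 1# n

  -- Degree `n` of a product involves only degrees at most `n` of the factors; this is why truncated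
  -- equality is a congruence for `_⊛_`.
  ⊛-cong : ∀ n {f f′ g g′} → (∀ i → i ≤ n → f i ≈ f′ i) → (∀ i → i ≤ n → g i ≈ g′ i) →
           (f ⊛ g) n ≈ (f′ ⊛ g′) n
  ⊛-cong zero    f≈ g≈ = *-cong (f≈ 0 z≤n) (g≈ 0 z≤n)
  ⊛-cong (suc n) f≈ g≈ = +-cong (*-cong (f≈ 0 z≤n) (g≈ (suc n) ℕ.≤-refl))
    (⊛-cong n (λ i i≤n → f≈ (suc i) (s≤s i≤n)) (λ i i≤n → g≈ i (ℕ.m≤n⇒m≤1+n i≤n)))

  ⊛-distribʳ-⊕ : ∀ h f g n → ((f ⊕ g) ⊛ h) n ≈ (f ⊛ h ⊕ g ⊛ h) n
  ⊛-distribʳ-⊕ h f g zero    = distribʳ _ _ _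
  ⊛-distribʳ-⊕ h f g (suc n) = begin
    (f 0 + g 0) * h (suc n) + ((f ⊕ g) ∘ suc ⊛ h) n
      ≈⟨ +-cong (distribʳ _ _ _) (⊛-distribʳ-⊕ h (f ∘ suc) (g ∘ suc) n) ⟩
    (f 0 * h (suc n) + g 0 * h (suc n)) + (((f ∘ suc) ⊛ h) n + ((g ∘ suc) ⊛ h) n)
      ≈⟨ interchange _ _ _ _ ⟩
    (f ⊛ h) (suc n) + (g ⊛ h) (suc n) ∎

  ⊛-zeroˡ : ∀ g n → (𝟘 ⊛ g) n ≈ 0#
  ⊛-zeroˡ g zero    = zeroˡ _
  ⊛-zeroˡ g (suc n) = trans (+-cong (zeroˡ _) (⊛-zeroˡ g n)) (+-identityˡ 0#)

  const-⊛ : ∀ a g n → (const a ⊛ g) n ≈ a * g n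
  const-⊛ a g zero    = refl
  const-⊛ a g (suc n) = trans (+-congˡ (⊛-zeroˡ g n)) (+-identityʳ _)

  ·-⊛-assoc : ∀ a f g n → ((a · f) ⊛ g) n ≈ a * (f ⊛ g) n
  ·-⊛-assoc a f g zero    = *-assoc _ _ _
  ·-⊛-assoc a f g (suc n) =
    trans (+-cong (*-assoc _ _ _) (·-⊛-assoc a (f ∘ suc) g n)) (sym (distribˡ _ _ _))

  ⊛-assoc : ∀ f g h n → ((f ⊛ g) ⊛ h) n ≈ (f ⊛ (g ⊛ h)) n
  ⊛-assoc f g h zero    = *-assoc _ _ _
  ⊛-assoc f g h (suc n) = begin
    (f 0 * g 0) * h (suc n) + ((f 0 · (g ∘ suc) ⊕ (f ∘ suc) ⊛ g) ⊛ h) n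
      ≈⟨ +-cong (*-assoc _ _ _) (⊛-distribʳ-⊕ h (f 0 · (g ∘ suc)) ((f ∘ suc) ⊛ g) n) ⟩
    f 0 * (g 0 * h (suc n)) + (((f 0 · (g ∘ suc)) ⊛ h) n + (((f ∘ suc) ⊛ g) ⊛ h) n)
      ≈⟨ +-congˡ (+-cong (·-⊛-assoc (f 0) (g ∘ suc) h n) (⊛-assoc (f ∘ suc) g h n)) ⟩
    f 0 * (g 0 * h (suc n)) + (f 0 * ((g ∘ suc) ⊛ h) n + ((f ∘ suc) ⊛ (g ⊛ h)) n)
      ≈⟨ +-assoc _ _ _ ⟨
    (f 0 * (g 0 * h (suc n)) + f 0 * ((g ∘ suc) ⊛ h) n) + ((f ∘ suc) ⊛ (g ⊛ h)) n
      ≈⟨ +-congʳ (distribˡ _ _ _) ⟨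
    (f ⊛ (g ⊛ h)) (suc n) ∎

  -- The product recurses on its left factor; the mirror-image recursion on the right factor is what
  -- commutativity needs.
  ⊛-suc : ∀ f g n → (f ⊛ g) (suc n) ≈ (f ⊛ (g ∘ suc)) n + f (suc n) * g 0
  ⊛-suc f g zero    = refl
  ⊛-suc f g (suc n) = trans (+-congˡ (⊛-suc (f ∘ suc) g n)) (sym (+-assoc _ _ _))

  ⊛-comm : ∀ f g n → (f ⊛ g) n ≈ (g ⊛ f) n
  ⊛-comm f g zero    = *-comm _ _
  ⊛-comm f g (suc n) = begin
    f 0 * g (suc n) + ((f ∘ suc) ⊛ g) n  ≈⟨ +-cong (*-comm _ _) (⊛-comm (f ∘ suc) g n) ⟩
    g (suc n) * f 0 + (g ⊛ (f ∘ suc)) n  ≈⟨ +-comm _ _ ⟩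
    (g ⊛ (f ∘ suc)) n + g (suc n) * f 0  ≈⟨ ⊛-suc g f n ⟨
    (g ⊛ f) (suc n)                      ∎

  ⊛-identityˡ : ∀ g n → (const 1# ⊛ g) n ≈ g n
  ⊛-identityˡ g n = trans (const-⊛ 1# g n) (*-identityˡ (g n))

  commutativeSemiring : CommutativeSemiring c ℓ
  commutativeSemiring = record
    { Carrier = Coefficients
    ; _≈_ = _≋_
    ; _+_ = _⊕_
    ; _*_ = _⊛_
    ; 0#  = 𝟘
    ; 1#  = const 1#
    ; isCommutativeSemiring = isCommutativeSemiringˡ record
      { +-isCommutativeMonoid = record
        { isMonoid = record
          { isSemigroup = record
            { isMagma = record
              { isEquivalence = ≋-isEquivalence
              ; ∙-cong = λ f≋ g≋ n n≤N → +-cong (f≋ n n≤N) (g≋ n n≤N) }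
            ; assoc = λ f g h n _ → +-assoc (f n) (g n) (h n) }
          ; identity = (λ f n _ → +-identityˡ (f n)) , (λ f n _ → +-identityʳ (f n)) }
        ; comm = λ f g n _ → +-comm (f n) (g n) }
      ; *-isCommutativeMonoid = record
        { isMonoid = record
          { isSemigroup = record
            { isMagma = record
              { isEquivalence = ≋-isEquivalence
              ; ∙-cong = λ f≋ g≋ n n≤N → ⊛-cong n
                  (λ i i≤n → f≋ i (ℕ.≤-trans i≤n n≤N)) (λ i i≤n → g≋ i (ℕ.≤-trans i≤n n≤N)) }
            ; assoc = λ f g h n _ → ⊛-assoc f g h n }
          ; identity = (λ g n _ → ⊛-identityˡ g n)
                     , (λ g n _ → trans (⊛-comm g (const 1#) n) (⊛-identityˡ g n)) }
        ; comm = λ f g n _ → ⊛-comm f g n }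
      ; distribʳ = λ h f g n _ → ⊛-distribʳ-⊕ h f g n
      ; zeroˡ = λ g n _ → ⊛-zeroˡ g n
      }
    }
    where
    ≋-isEquivalence : IsEquivalence _≋_
    ≋-isEquivalence = record
      { refl  = λ _ _ → refl
      ; sym   = λ f≋g n n≤N → sym (f≋g n n≤N)
      ; trans = λ f≋g g≋h n n≤N → trans (f≋g n n≤N) (g≋h n n≤N) }

  open import Algebra.Definitions.RawSemiring (CommutativeSemiring.rawSemiring commutativeSemiring)
    public using (_^_)

  X-⊛-suc : ∀ g n → (X ⊛ g) (suc n) ≈ g n
  X-⊛-suc g n = trans (+-cong (zeroˡ _) (⊛-identityˡ g n)) (+-identityˡ _)

  X^-⊛-≥ : ∀ k g n → ((X ^ k) ⊛ g) (k ℕ.+ n) ≈ g n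
  X^-⊛-≥ zero    g n = ⊛-identityˡ g n
  X^-⊛-≥ (suc k) g n = begin
    ((X ⊛ X ^ k) ⊛ g) (suc k ℕ.+ n)  ≈⟨ ⊛-assoc X (X ^ k) g (suc k ℕ.+ n) ⟩
    (X ⊛ (X ^ k ⊛ g)) (suc k ℕ.+ n)  ≈⟨ X-⊛-suc (X ^ k ⊛ g) (k ℕ.+ n) ⟩
    (X ^ k ⊛ g) (k ℕ.+ n)            ≈⟨ X^-⊛-≥ k g n ⟩
    g n                              ∎

  X^-⊛-< : ∀ k g n → n ℕ.< k → ((X ^ k) ⊛ g) n ≈ 0#
  X^-⊛-< (suc k) g zero    _         = trans (*-congʳ (zeroˡ _)) (zeroˡ _)
  X^-⊛-< (suc k) g (suc n) (s≤s n<k) = begin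
    ((X ⊛ X ^ k) ⊛ g) (suc n)  ≈⟨ ⊛-assoc X (X ^ k) g (suc n) ⟩
    (X ⊛ (X ^ k ⊛ g)) (suc n)  ≈⟨ X-⊛-suc (X ^ k ⊛ g) n ⟩
    (X ^ k ⊛ g) n              ≈⟨ X^-⊛-< k g n n<k ⟩
    0#                         ∎

  X^-diagonal : ∀ k → (X ^ k) k ≈ 1#
  X^-diagonal zero    = refl
  X^-diagonal (suc k) = trans (X-⊛-suc (X ^ k) k) (X^-diagonal k)

  X^-off-diagonal : ∀ {k n} → k ≢ n → (X ^ k) n ≈ 0#
  X^-off-diagonal {zero}  {zero}  k≢n = contradiction ≡.refl k≢n
  X^-off-diagonal {zero}  {suc n} _   = refl
  X^-off-diagonal {suc k} {zero}  _   = zeroˡ _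
  X^-off-diagonal {suc k} {suc n} k≢n =
    trans (X-⊛-suc (X ^ k) n) (X^-off-diagonal (k≢n ∘ ≡.cong suc))

  -- The only nonzero coefficient sits in degree `suc N`, just beyond the truncation.
  X^-nilpotent : X ^ suc N ≋ 𝟘
  X^-nilpotent n n≤N = X^-off-diagonal {suc N} {n} λ { ≡.refl → ℕ.1+n≰n n≤N }

-- Geometric series of nilpotent elements

module Geometric {c ℓ : Level} (S : CommutativeSemiring c ℓ) (N : ℕ) where

  open CommutativeSemiring S
  open import Relation.Binary.Reasoning.Setoid setoid
  open import Algebra.Properties.Semiring.Exp semiring public
  open import Algebra.Properties.CommutativeSemiring.Exp S public using (^-distrib-*)
  open import Algebra.Solver.Ring.NaturalCoefficients.Default S using (solve; _:=_; _:+_; _:*_; con)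
  open BigOperator +-commutativeMonoid public
    renaming (big to ∑; big-cong to ∑-cong; big-ε to ∑-0; big-∙ to ∑-+; big-first to ∑-first)
    hiding (big-+; big-truncate; big-double)
  open BigOperator *-commutativeMonoid public
    renaming (big to ∏; big-cong to ∏-cong; big-ε to ∏-1; big-∙ to ∏-*; big-first to ∏-first;
              big-truncate to ∏-truncate; big-double to ∏-double)
    hiding (big-+)

  K : ℕ
  K = suc N

  ∑-*ˡ : ∀ n a f → ∑ n (λ i → a * f i) ≈ a * ∑ n f
  ∑-*ˡ zero    a f = sym (zeroʳ a)
  ∑-*ˡ (suc n) a f = trans (+-congʳ (∑-*ˡ n a f)) (sym (distribˡ _ _ _))

  -- One exponent `K` serves for all elements, so that `γ` can be a sum of fixed length.
  Nilpotent : Carrier → Set ℓ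
  Nilpotent x = x ^ K ≈ 0#

  nilpotent-*ˡ : ∀ y {x} → Nilpotent x → Nilpotent (y * x)
  nilpotent-*ˡ y {x} x^K≈0 = begin
    (y * x) ^ K    ≈⟨ ^-distrib-* y x K ⟩
    y ^ K * x ^ K  ≈⟨ *-congˡ x^K≈0 ⟩
    y ^ K * 0#     ≈⟨ zeroʳ _ ⟩
    0#             ∎

  nilpotent-*ʳ : ∀ {x} y → Nilpotent x → Nilpotent (x * y)
  nilpotent-*ʳ y nx = trans (^-congˡ K (*-comm _ y)) (nilpotent-*ˡ y nx)

  ^-vanish : ∀ {x n} → Nilpotent x → K ≤ n → x ^ n ≈ 0#
  ^-vanish {x} {n} x^K≈0 K≤n = begin
    x ^ n                      ≡⟨ ≡.cong (x ^_) (ℕ.m+[n∸m]≡n K≤n) ⟨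
    x ^ (K ℕ.+ (n ℕ.∸ K))      ≈⟨ ^-homo-* x K (n ℕ.∸ K) ⟩
    x ^ K * x ^ (n ℕ.∸ K)      ≈⟨ *-congʳ x^K≈0 ⟩
    0# * x ^ (n ℕ.∸ K)         ≈⟨ zeroˡ _ ⟩
    0#                         ∎

  1^n≈1 : ∀ n → 1# ^ n ≈ 1#
  1^n≈1 zero    = refl
  1^n≈1 (suc n) = trans (*-identityˡ _) (1^n≈1 n)

  γ : Carrier → Carrier
  γ x = ∑ K (x ^_)

  γ-cong : ∀ {x y} → x ≈ y → γ x ≈ γ y
  γ-cong x≈y = ∑-cong K λ i _ → ^-congˡ i x≈y

  -- Appending the vanishing term `x ^ K` to the sum makes room for splitting off its first term.
  γ-unfold : ∀ {x} → Nilpotent x → γ x ≈ 1# + x * γ x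
  γ-unfold {x} x^K≈0 = begin
    γ x                         ≈⟨ +-identityʳ _ ⟨
    γ x + 0#                    ≈⟨ +-congˡ x^K≈0 ⟨
    ∑ (suc K) (x ^_)            ≈⟨ ∑-first K (x ^_) ⟩
    1# + ∑ K (λ i → x * x ^ i)  ≈⟨ +-congˡ (∑-*ˡ K x (x ^_)) ⟩
    1# + x * γ x                ∎

  -- Division by `1 - x` without subtraction: substituting the equation into itself `K` times leaves
  -- the remainder `x ^ K * a`, which is 0.
  γ-unique : ∀ {x a b} → Nilpotent x → a ≈ b + x * a → a ≈ γ x * b
  γ-unique {x} {a} {b} x^K≈0 eq = begin
    a                    ≈⟨ iterate K ⟩
    γ x * b + x ^ K * a  ≈⟨ +-congˡ (trans (*-congʳ x^K≈0) (zeroˡ a)) ⟩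
    γ x * b + 0#         ≈⟨ +-identityʳ _ ⟩
    γ x * b              ∎
    where
    iterate : ∀ n → a ≈ ∑ n (x ^_) * b + x ^ n * a
    iterate zero    = solve 2 (λ a b → a := con 0 :* b :+ con 1 :* a) refl a b
    iterate (suc n) = begin
      a                                     ≈⟨ iterate n ⟩
      ∑ n (x ^_) * b + x ^ n * a            ≈⟨ +-congˡ (*-congˡ eq) ⟩
      ∑ n (x ^_) * b + x ^ n * (b + x * a)
        ≈⟨ solve 5 (λ s b p x a → s :* b :+ p :* (b :+ x :* a) := (s :+ p) :* b :+ (x :* p) :* a)
             refl (∑ n (x ^_)) b (x ^ n) x a ⟩
      ∑ (suc n) (x ^_) * b + x ^ suc n * a  ∎

  γ-0 : ∀ {x} → x ≈ 0# → γ x ≈ 1#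
  γ-0 {x} x≈0 = begin
    γ x            ≈⟨ γ-unfold (trans (^-congˡ K x≈0) (zeroˡ _)) ⟩
    1# + x * γ x   ≈⟨ +-congˡ (trans (*-congʳ x≈0) (zeroˡ _)) ⟩
    1# + 0#        ≈⟨ +-identityʳ 1# ⟩
    1#             ∎

  -- Subtraction-free form of `1 - x² = (1 - x)(1 + x)`: the right-hand side solves `a = 1 + x a`,
  -- whose only solution is `γ x`.
  γ-square : ∀ {x} → Nilpotent x → γ x ≈ (1# + x) * γ (x * x)
  γ-square {x} nx = sym (trans (γ-unique nx fixed) (*-identityʳ _))
    where
    g = γ (x * x)
    fixed : (1# + x) * g ≈ 1# + x * ((1# + x) * g)
    fixed = begin
      (1# + x) * g                  ≈⟨ solve 2 (λ x g → (con 1 :+ x) :* g := g :+ x :* g) refl x g ⟩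
      g + x * g                     ≈⟨ +-congʳ (γ-unfold (nilpotent-*ˡ x nx)) ⟩
      (1# + x * x * g) + x * g
        ≈⟨ solve 2 (λ x g → (con 1 :+ x :* x :* g) :+ x :* g := con 1 :+ x :* ((con 1 :+ x) :* g)) refl x g ⟩
      1# + x * ((1# + x) * g)       ∎

-- Lebesgue's identity

module Lebesgue {c ℓ : Level} (S : CommutativeSemiring c ℓ) (N : ℕ)
                (Q : CommutativeSemiring.Carrier S)
                (Q-nilpotent : Geometric.Nilpotent S N Q) where

  open CommutativeSemiring S
  open Geometric S N
  open import Relation.Binary.Reasoning.Setoid setoid
  open import Algebra.Solver.Ring.NaturalCoefficients.Default S using (solve; _:=_; _:+_; _:*_; con)

  vanish-*^ : ∀ w {n} → K ≤ n → w * Q ^ n ≈ 0#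
  vanish-*^ w K≤n = trans (*-congˡ (^-vanish Q-nilpotent K≤n)) (zeroʳ w)

  -- The reciprocal of the Pochhammer symbol `(x; Q)_n`. In the infinite version below, `K` factors
  -- are enough because all later ones are `γ 0`, that is 1.
  1/[_]_ : Carrier → ℕ → Carrier
  1/[ x ] n = ∏ n λ i → γ (x * Q ^ i)

  1/[_]∞ : Carrier → Carrier
  1/[ x ]∞ = 1/[ x ] K

  1/[]∞-cong : ∀ {x y} → x ≈ y → 1/[ x ]∞ ≈ 1/[ y ]∞
  1/[]∞-cong x≈y = ∏-cong K λ i _ → γ-cong (*-congʳ x≈y)

  1/[]∞-0 : ∀ {x} → x ≈ 0# → 1/[ x ]∞ ≈ 1#
  1/[]∞-0 x≈0 = ∏-1 K λ i _ → γ-0 (trans (*-congʳ x≈0) (zeroˡ _))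

  -- Every factor that occurs in only one of the two products contains a power of `Q` with exponent
  -- at least `K`, so it equals 1.
  1/[]-stable : ∀ w a d → K ≤ a ℕ.+ d → 1/[ w * Q ^ a ] d ≈ 1/[ w * Q ^ a ]∞
  1/[]-stable w a d K≤a+d with ℕ.≤-total d K
  ... | inj₁ d≤K = sym (∏-truncate _ d≤K λ i d≤i → γ-0 (begin
          w * Q ^ a * Q ^ i    ≈⟨ *-assoc _ _ _ ⟩
          w * (Q ^ a * Q ^ i)  ≈⟨ *-congˡ (^-homo-* Q a i) ⟨
          w * Q ^ (a ℕ.+ i)    ≈⟨ vanish-*^ w (ℕ.≤-trans K≤a+d (ℕ.+-monoʳ-≤ a d≤i)) ⟩
          0#                   ∎))
  ... | inj₂ K≤d = ∏-truncate _ K≤d λ i K≤i → γ-0 (vanish-*^ _ K≤i)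

  -- Removing the first factor replaces `x` by `x * Q`; without subtraction, multiplying by `1 - x`
  -- becomes a recurrence.
  1/[]∞-step : ∀ {x} → Nilpotent x → 1/[ x ]∞ ≈ 1/[ x * Q ]∞ + x * 1/[ x ]∞
  1/[]∞-step {x} nx = begin
    1/[ x ]∞                               ≈⟨ first ⟩
    γ x * 1/[ x * Q ]∞                     ≈⟨ *-congʳ (γ-unfold nx) ⟩
    (1# + x * γ x) * 1/[ x * Q ]∞
      ≈⟨ solve 3 (λ x g p → (con 1 :+ x :* g) :* p := p :+ x :* (g :* p)) refl x (γ x) 1/[ x * Q ]∞ ⟩
    1/[ x * Q ]∞ + x * (γ x * 1/[ x * Q ]∞) ≈⟨ +-congˡ (*-congˡ first) ⟨
    1/[ x * Q ]∞ + x * 1/[ x ]∞            ∎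
    where
    first : 1/[ x ]∞ ≈ γ x * 1/[ x * Q ]∞
    first = begin
      -- The added factor of index `K` is 1, and with it `K` factors remain after the first is split
      -- off.
      1/[ x ]∞                                                ≈⟨ ∏-truncate _ (ℕ.n≤1+n K) (λ i K≤i → γ-0 (vanish-*^ x K≤i)) ⟨
      1/[ x ] (suc K)                                         ≈⟨ ∏-first K _ ⟩
      γ (x * 1#) * ∏ K (λ i → γ (x * (Q * Q ^ i)))
        ≈⟨ *-cong (γ-cong (*-identityʳ x)) (∏-cong K λ i _ → γ-cong (sym (*-assoc _ _ _))) ⟩
      γ x * 1/[ x * Q ]∞                                      ∎

  -- t k = Q^(k(k+1)/2) / ((1 - Q) ⋯ (1 - Q^k))
  t : ℕ → Carrier
  t zero    = 1#
  t (suc k) = γ (Q ^ suc k) * (Q ^ suc k * t k)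

  -- The relation `(1 - Q^(k+1)) t (k+1) = Q^(k+1) t k`, free of subtraction. It drives both
  -- functional equations below.
  t-step : ∀ k → t (suc k) ≈ Q ^ suc k * t k + Q ^ suc k * t (suc k)
  t-step k = begin
    γ p * (p * t k)            ≈⟨ *-congʳ (γ-unfold (nilpotent-*ʳ (Q ^ k) Q-nilpotent)) ⟩
    (1# + p * γ p) * (p * t k)
      ≈⟨ solve 3 (λ p g s → (con 1 :+ p :* g) :* (p :* s) := p :* s :+ p :* (g :* (p :* s))) refl p (γ p) (t k) ⟩
    p * t k + p * t (suc k)    ∎
    where p = Q ^ suc k

  -- The factor `Q ^ K` is already 0. Hence sums weighted by `t` over indices below `K` can be
  -- shifted as if they were infinite.
  t-vanish : t K ≈ 0#
  t-vanish = trans (*-congˡ (trans (*-congʳ Q-nilpotent) (zeroˡ _))) (zeroʳ _)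

  ∑-shift : ∀ f → f K ≈ 0# → ∑ K f ≈ f 0 + ∑ K (f ∘ suc)
  ∑-shift f fK≈0 = begin
    ∑ K f                ≈⟨ +-identityʳ _ ⟨
    ∑ K f + 0#           ≈⟨ +-congˡ fK≈0 ⟨
    ∑ (suc K) f          ≈⟨ ∑-first K f ⟩
    f 0 + ∑ K (f ∘ suc)  ∎

  t*-shift : ∀ (f : ℕ → Carrier) → ∑ K (λ k → t k * f k) ≈ t 0 * f 0 + ∑ K (λ k → t (suc k) * f (suc k))
  t*-shift f = ∑-shift _ (trans (*-congʳ t-vanish) (zeroˡ _))

  F : Carrier → Carrier
  F w = ∑ K λ k → t k * 1/[ w * Q ^ (2 ℕ.+ k) ]∞

  F-cong : ∀ {w w′} → w ≈ w′ → F w ≈ F w′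
  F-cong w≈ = ∑-cong K λ k _ → *-congˡ (1/[]∞-cong (*-congʳ w≈))

  -- Two uses of `1/[]∞-step` write `a k` as `a (2 + k)` plus two terms divisible by `w * (Q * Q)`.
  -- The terms `a (2 + k)` sum to `F (w * (Q * Q))`, and the rest regroups into `F w` itself.
  F-step : ∀ w → F w ≈ F (w * (Q * Q)) + w * (Q * Q) * F w
  F-step w = begin
    F w
      ≈⟨ ∑-cong K (λ k _ → term k) ⟩
    ∑ K (λ k → t k * a (2 ℕ.+ k) + w * (Q * Q) * (u k + Q ^ k * (t k * a k)))
      ≈⟨ ∑-+ K ⟩
    ∑ K (λ k → t k * a (2 ℕ.+ k)) + ∑ K (λ k → w * (Q * Q) * (u k + Q ^ k * (t k * a k)))
      ≈⟨ +-cong (∑-cong K λ k _ → *-congˡ (1/[]∞-cong (shift₂ k))) (trans (∑-*ˡ K _ _) (*-congˡ inner)) ⟩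
    F (w * (Q * Q)) + w * (Q * Q) * F w
      ∎
    where
    a u : ℕ → Carrier
    a k = 1/[ w * Q ^ (2 ℕ.+ k) ]∞
    u k = Q ^ suc k * (t k * a (suc k))

    shift₂ : ∀ k → w * Q ^ (4 ℕ.+ k) ≈ w * (Q * Q) * Q ^ (2 ℕ.+ k)
    shift₂ k = solve 3 (λ w q p → w :* (q :* (q :* (q :* (q :* p)))) := w :* (q :* q) :* (q :* (q :* p))) refl w Q (Q ^ k)

    a-step : ∀ k → a k ≈ a (suc k) + w * Q ^ (2 ℕ.+ k) * a k
    a-step k = trans (1/[]∞-step (nilpotent-*ˡ w (nilpotent-*ʳ (Q ^ suc k) Q-nilpotent)))
      (+-congʳ (1/[]∞-cong (solve 3 (λ w q p → w :* p :* q := w :* (q :* p)) refl w Q (Q ^ (2 ℕ.+ k)))))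

    term : ∀ k → t k * a k ≈ t k * a (2 ℕ.+ k) + w * (Q * Q) * (u k + Q ^ k * (t k * a k))
    term k = begin
      t k * a k
        ≈⟨ *-congˡ (trans (a-step k) (+-congʳ (a-step (suc k)))) ⟩
      t k * ((a (2 ℕ.+ k) + w * Q ^ (3 ℕ.+ k) * a (suc k)) + w * Q ^ (2 ℕ.+ k) * a k)
        ≈⟨ solve 7 (λ s a₀ a₁ a₂ w q p →
             s :* ((a₂ :+ w :* (q :* (q :* (q :* p))) :* a₁) :+ w :* (q :* (q :* p)) :* a₀)
             := s :* a₂ :+ w :* (q :* q) :* (q :* p :* (s :* a₁) :+ p :* (s :* a₀)))
             refl (t k) (a k) (a (suc k)) (a (2 ℕ.+ k)) w Q (Q ^ k) ⟩
      t k * a (2 ℕ.+ k) + w * (Q * Q) * (u k + Q ^ k * (t k * a k))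
        ∎

    inner : ∑ K (λ k → u k + Q ^ k * (t k * a k)) ≈ F w
    inner = begin
      ∑ K (λ k → u k + Q ^ k * (t k * a k))
        ≈⟨ ∑-+ K ⟩
      ∑ K u + ∑ K (λ k → Q ^ k * (t k * a k))
        -- After shifting the second sum by one, both sums carry `a (suc k)`, with coefficients
        -- `Q ^ suc k * t k` and `Q ^ suc k * t (suc k)`; by `t-step` these add up to `t (suc k)`.
        ≈⟨ +-congˡ (∑-shift _ (trans (*-congˡ (trans (*-congʳ t-vanish) (zeroˡ _))) (zeroʳ _))) ⟩
      ∑ K u + (1# * (t 0 * a 0) + ∑ K (λ k → Q ^ suc k * (t (suc k) * a (suc k))))
        ≈⟨ solve 3 (λ x y z → x :+ (con 1 :* y :+ z) := y :+ (x :+ z)) refl _ _ _ ⟩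
      t 0 * a 0 + (∑ K u + ∑ K (λ k → Q ^ suc k * (t (suc k) * a (suc k))))
        ≈⟨ +-congˡ (∑-+ K) ⟨
      t 0 * a 0 + ∑ K (λ k → u k + Q ^ suc k * (t (suc k) * a (suc k)))
        ≈⟨ +-congˡ (∑-cong K λ k _ → trans
             (solve 4 (λ p s s′ a → p :* (s :* a) :+ p :* (s′ :* a) := (p :* s :+ p :* s′) :* a)
                refl (Q ^ suc k) (t k) (t (suc k)) (a (suc k)))
             (*-congʳ (sym (t-step k)))) ⟩
      t 0 * a 0 + ∑ K (λ k → t (suc k) * a (suc k))
        ≈⟨ t*-shift a ⟨
      F w
        ∎

  -- Iterates `F-step`: each time `γ-unique` solves the recurrence for `F`, which releases one
  -- factor and multiplies the argument by `Q * Q`.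
  F-product : ∀ w n → F w ≈ ∏ n (λ i → γ (w * (Q * Q) ^ suc i)) * F (w * (Q * Q) ^ n)
  F-product w zero    = trans (F-cong (sym (*-identityʳ w))) (sym (*-identityˡ _))
  F-product w (suc n) = begin
    F w                                                        ≈⟨ F-product w n ⟩
    p * F v
      ≈⟨ *-congˡ (γ-unique (nilpotent-*ˡ v (nilpotent-*ˡ Q Q-nilpotent)) (F-step v)) ⟩
    p * (γ (v * (Q * Q)) * F (v * (Q * Q)))                    ≈⟨ *-congˡ (*-cong (γ-cong v*QQ) (F-cong v*QQ)) ⟩
    p * (γ (w * (Q * Q) ^ suc n) * F (w * (Q * Q) ^ suc n))    ≈⟨ *-assoc _ _ _ ⟨
    p * γ (w * (Q * Q) ^ suc n) * F (w * (Q * Q) ^ suc n)      ∎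
    where
    p = ∏ n (λ i → γ (w * (Q * Q) ^ suc i))
    v = w * (Q * Q) ^ n
    v*QQ : v * (Q * Q) ≈ w * (Q * Q) ^ suc n
    v*QQ = solve 3 (λ w x y → w :* x :* y := w :* (y :* x)) refl w ((Q * Q) ^ n) (Q * Q)

  -- Euler's series for the product of all `1 + x Q^i` with `i ≥ 1`. The sum of the `t k` is `H 1#`;
  -- the variable `x` provides a functional equation to evaluate it.
  H : Carrier → Carrier
  H x = ∑ K λ k → t k * x ^ k

  H-cong : ∀ {x y} → x ≈ y → H x ≈ H y
  H-cong x≈y = ∑-cong K λ k _ → *-congˡ (^-congˡ k x≈y)

  -- Applying `t-step` to every term after the first splits the series into `H (x * Q)` and `x * Q`
  -- times `H (x * Q)`.
  H-step : ∀ x → H x ≈ (1# + x * Q) * H (x * Q)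
  H-step x = begin
    H x
      ≈⟨ t*-shift (x ^_) ⟩
    t 0 * 1# + ∑ K (λ k → t (suc k) * x ^ suc k)
      ≈⟨ +-congˡ (∑-cong K λ k _ → term k) ⟩
    t 0 * 1# + ∑ K (λ k → t (suc k) * (x * Q) ^ suc k + x * Q * (t k * (x * Q) ^ k))
      ≈⟨ +-congˡ (trans (∑-+ K) (+-congˡ (∑-*ˡ K _ _))) ⟩
    t 0 * 1# + (∑ K (λ k → t (suc k) * (x * Q) ^ suc k) + x * Q * H (x * Q))
      ≈⟨ +-assoc _ _ _ ⟨
    (t 0 * 1# + ∑ K (λ k → t (suc k) * (x * Q) ^ suc k)) + x * Q * H (x * Q)
      ≈⟨ +-congʳ (t*-shift ((x * Q) ^_)) ⟨
    H (x * Q) + x * Q * H (x * Q)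
      ≈⟨ solve 2 (λ y h → h :+ y :* h := (con 1 :+ y) :* h) refl (x * Q) (H (x * Q)) ⟩
    (1# + x * Q) * H (x * Q)
      ∎
    where
    term : ∀ k → t (suc k) * x ^ suc k ≈ t (suc k) * (x * Q) ^ suc k + x * Q * (t k * (x * Q) ^ k)
    term k = begin
      t (suc k) * x ^ suc k
        ≈⟨ *-congʳ (t-step k) ⟩
      (Q ^ suc k * t k + Q ^ suc k * t (suc k)) * x ^ suc k
        ≈⟨ solve 6 (λ q p s s′ x y → (q :* p :* s :+ q :* p :* s′) :* (x :* y)
             := s′ :* (x :* q :* (y :* p)) :+ x :* q :* (s :* (y :* p)))
             refl Q (Q ^ k) (t k) (t (suc k)) x (x ^ k) ⟩
      t (suc k) * (x * Q * (x ^ k * Q ^ k)) + x * Q * (t k * (x ^ k * Q ^ k))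
        ≈⟨ +-cong (*-congˡ (*-congˡ (^-distrib-* x Q k))) (*-congˡ (*-congˡ (^-distrib-* x Q k))) ⟨
      t (suc k) * (x * Q) ^ suc k + x * Q * (t k * (x * Q) ^ k)
        ∎

  H-0 : ∀ {x} → x ≈ 0# → H x ≈ 1#
  H-0 {x} x≈0 = begin
    H x                                           ≈⟨ t*-shift (x ^_) ⟩
    1# * 1# + ∑ K (λ k → t (suc k) * x ^ suc k)   ≈⟨ +-cong (*-identityˡ 1#) (∑-0 K λ k _ →
                                                       trans (*-congˡ (trans (*-congʳ x≈0) (zeroˡ _))) (zeroʳ _)) ⟩
    1# + 0#                                       ≈⟨ +-identityʳ 1# ⟩
    1#                                            ∎

  H-product : ∀ n → H 1# ≈ ∏ n (λ i → 1# + Q ^ suc i) * H (Q ^ n)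
  H-product zero    = sym (*-identityˡ _)
  H-product (suc n) = begin
    H 1#                                      ≈⟨ H-product n ⟩
    p * H (Q ^ n)                             ≈⟨ *-congˡ (H-step (Q ^ n)) ⟩
    p * ((1# + Q ^ n * Q) * H (Q ^ n * Q))    ≈⟨ *-congˡ (*-cong (+-congˡ (*-comm _ _)) (H-cong (*-comm _ _))) ⟩
    p * ((1# + Q ^ suc n) * H (Q ^ suc n))    ≈⟨ *-assoc _ _ _ ⟨
    p * (1# + Q ^ suc n) * H (Q ^ suc n)      ∎
    where p = ∏ n (λ i → 1# + Q ^ suc i)

  -- At 0 every denominator is 1, so `F` becomes `H 1#`; after `K` steps the argument of `H` is
  -- `Q ^ K`, which is 0.
  F-0 : ∀ {w} → w ≈ 0# → F w ≈ ∏ K (λ i → 1# + Q ^ suc i)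
  F-0 {w} w≈0 = begin
    F w                                      ≈⟨ ∑-cong K (λ k _ → *-congˡ (trans
                                                  (1/[]∞-0 (trans (*-congʳ w≈0) (zeroˡ _))) (sym (1^n≈1 k)))) ⟩
    H 1#                                     ≈⟨ H-product K ⟩
    ∏ K (λ i → 1# + Q ^ suc i) * H (Q ^ K)   ≈⟨ trans (*-congˡ (H-0 Q-nilpotent)) (*-identityʳ _) ⟩
    ∏ K (λ i → 1# + Q ^ suc i)               ∎

  lebesgue : ∀ w → F w ≈ ∏ K (λ i → γ (w * (Q * Q) ^ suc i)) * ∏ K (λ i → 1# + Q ^ suc i)
  lebesgue w = trans (F-product w K)
    (*-congˡ (F-0 (trans (*-congˡ (nilpotent-*ˡ Q Q-nilpotent)) (zeroʳ w))))

-- Euler's theorem on distinct and odd parts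

module Euler {c ℓ : Level} (S : CommutativeSemiring c ℓ) (N : ℕ) where

  open CommutativeSemiring S
  open Geometric S N
  open import Relation.Binary.Reasoning.Setoid setoid
  open import Algebra.Solver.Ring.NaturalCoefficients.Default S using (solve; _:=_; _:*_)

  distinct distinctOdd odd : Carrier → Carrier
  distinct    y = ∏ K λ i → 1# + y ^ suc i
  distinctOdd y = ∏ K λ i → 1# + y * (y * y) ^ i
  odd         y = ∏ K λ i → γ (y * (y * y) ^ i)

  square-^ : ∀ y n → (y * y) ^ n ≈ y ^ (n ℕ.* 2)
  square-^ y n = begin
    (y * y) ^ n         ≈⟨ ^-congˡ n (*-congˡ (*-identityʳ y)) ⟨
    (y ^ 2) ^ n         ≈⟨ ^-assocʳ y 2 n ⟩
    y ^ (2 ℕ.* n)       ≡⟨ ≡.cong (y ^_) (ℕ.*-comm 2 n) ⟩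
    y ^ (n ℕ.* 2)       ∎

  -- Doubling the number of factors adds only factors 1; then the exponents `2i + 1` and `2i + 2`
  -- are paired.
  distinct-split : ∀ {y} → Nilpotent y → distinct y ≈ distinctOdd y * distinct (y * y)
  distinct-split {y} ny = begin
    distinct y
      ≈⟨ ∏-truncate _ (ℕ.m≤m*n K 2) (λ i K≤i → trans (+-congˡ (^-vanish ny (ℕ.m≤n⇒m≤1+n K≤i))) (+-identityʳ 1#)) ⟨
    ∏ (K ℕ.* 2) (λ i → 1# + y ^ suc i)
      ≈⟨ ∏-double K _ ⟩
    ∏ K (λ i → (1# + y * y ^ (i ℕ.* 2)) * (1# + y ^ (suc i ℕ.* 2)))
      ≈⟨ ∏-cong K (λ i _ → *-cong (+-congˡ (*-congˡ (square-^ y i))) (+-congˡ (square-^ y (suc i)))) ⟨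
    ∏ K (λ i → (1# + y * (y * y) ^ i) * (1# + (y * y) ^ suc i))
      ≈⟨ ∏-* K ⟩
    distinctOdd y * distinct (y * y)
      ∎

  odd-split : ∀ {y} → Nilpotent y → odd y ≈ distinctOdd y * odd (y * y)
  odd-split {y} ny = begin
    odd y
      ≈⟨ ∏-cong K (λ i _ → γ-square (nilpotent-*ʳ ((y * y) ^ i) ny)) ⟩
    ∏ K (λ i → (1# + y * (y * y) ^ i) * γ (y * (y * y) ^ i * (y * (y * y) ^ i)))
      ≈⟨ ∏-* K ⟩
    distinctOdd y * ∏ K (λ i → γ (y * (y * y) ^ i * (y * (y * y) ^ i)))
      ≈⟨ *-congˡ (∏-cong K λ i _ → γ-cong (trans
           (solve 2 (λ y p → y :* p :* (y :* p) := y :* y :* (p :* p)) refl y ((y * y) ^ i))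
           (*-congˡ (sym (^-distrib-* (y * y) (y * y) i))))) ⟩
    distinctOdd y * odd (y * y)
      ∎

  -- Both products satisfy `f y = distinctOdd y * f (y * y)`, and both are 1 at 0. Since
  -- `K < 2 ^ K`, squaring `K` times turns `y` into 0.
  distinct≈odd : ∀ {y} → Nilpotent y → distinct y ≈ odd y
  distinct≈odd {y} ny = descend K ny (^-vanish ny (ℕ.<⇒≤ (n<2^n K)))
    where
    n<2^n : ∀ n → n ℕ.< 2 ℕ.^ n
    n<2^n zero    = s≤s z≤n
    n<2^n (suc n) = ℕ.+-mono-≤ (ℕ.≤-trans (s≤s z≤n) (n<2^n n)) (ℕ.≤-trans (n<2^n n) (ℕ.m≤m+n _ 0))

    -- Passing from y to y² divides both sides by distinctOdd y.
    descend : ∀ n {y} → Nilpotent y → y ^ (2 ℕ.^ n) ≈ 0# → distinct y ≈ odd y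
    descend zero {y} _ y¹≈0 = trans
      (∏-1 K λ i _ → trans (+-congˡ (trans (*-congʳ y≈0) (zeroˡ _))) (+-identityʳ 1#))
      (sym (∏-1 K λ i _ → γ-0 (trans (*-congʳ y≈0) (zeroˡ _))))
      where y≈0 = trans (sym (*-identityʳ y)) y¹≈0
    descend (suc n) {y} ny y^≈0 = begin
      distinct y                        ≈⟨ distinct-split ny ⟩
      distinctOdd y * distinct (y * y)  ≈⟨ *-congˡ (descend n (nilpotent-*ˡ y ny) (begin
          (y * y) ^ (2 ℕ.^ n)             ≈⟨ square-^ y (2 ℕ.^ n) ⟩
          y ^ (2 ℕ.^ n ℕ.* 2)             ≡⟨ ≡.cong (y ^_) (ℕ.*-comm (2 ℕ.^ n) 2) ⟩
          y ^ (2 ℕ.^ suc n)               ≈⟨ y^≈0 ⟩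
          0#                              ∎)) ⟩
      distinctOdd y * odd (y * y)       ≈⟨ odd-split ny ⟨
      odd y                             ∎

-- Independence of the enumeration from generous bounds

-- A partition of `n` has at most `n` parts. The recursion of `boundedPartitions` may pass on a
-- length bound larger than the remaining total, whereas `enum` below keeps the two equal.
boundedPartitions-fuel : ∀ {l l′} m {n} → n ≤ l → n ≤ l′ →
                         boundedPartitions l m n ≡ boundedPartitions l′ m n
boundedPartitions-fuel m       {zero}  _       _        = ≡.refl
boundedPartitions-fuel zero    {suc n} (s≤s _) (s≤s _)  = ≡.refl
boundedPartitions-fuel (suc m) {suc n} (s≤s n≤l) (s≤s n≤l′) = ≡.cong₂ _++_
  (boundedPartitions-fuel m (s≤s n≤l) (s≤s n≤l′))
  (≡.cong (λ πs → if m ≤ᵇ n then map (suc m ∷_) πs else [])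
    (boundedPartitions-fuel (suc m) (ℕ.≤-trans (ℕ.m∸n≤m n m) n≤l) (ℕ.≤-trans (ℕ.m∸n≤m n m) n≤l′)))

-- Parts larger than `n` cannot occur. This allows the bound on the parts to be a convenient
-- multiple of 2 or 4.
boundedPartitions-large : ∀ l {m} n → n ≤ m → boundedPartitions l m n ≡ boundedPartitions l n n
boundedPartitions-large l {m} n n≤m =
  ≡.trans (≡.cong (λ k → boundedPartitions l k n) (≡.sym (ℕ.m∸n+n≡m n≤m))) (go (m ℕ.∸ n))
  where
  step : ∀ l {m} n → n ≤ m → boundedPartitions l (suc m) n ≡ boundedPartitions l m n
  step l       zero    _ = ≡.refl
  step zero    (suc n) _ = ≡.refl
  step (suc l) {m} (suc n) n<m with m ≤ᵇ n | ℕ.≤ᵇ-reflects-≤ m n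
  ... | true  | ofʸ m≤n = contradiction m≤n (ℕ.<⇒≱ n<m)
  ... | false | _       = ++-identityʳ _
  go : ∀ d → boundedPartitions l (d ℕ.+ n) n ≡ boundedPartitions l n n
  go zero    = ≡.refl
  go (suc d) = ≡.trans (step l n (ℕ.m≤n+m n d)) (go d)

-- Generating functions of weighted partitions

module Enumeration {c ℓ : Level} (R : CommutativeSemiring c ℓ) (N : ℕ) where

  open CommutativeSemiring R
  open Series R N
  open import Relation.Binary.Reasoning.Setoid setoid
  open import Algebra.Properties.CommutativeSemigroup +-commutativeSemigroup using (interchange)
  private module S = CommutativeSemiring commutativeSemiring
  open Geometric commutativeSemiring N hiding (_^_)

  total : {A : Set} → (A → Carrier) → List A → Carrier
  total f []       = 0#
  total f (x ∷ xs) = f x + total f xs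

  module _ {A : Set} where

    total-++ : ∀ (f : A → Carrier) xs ys → total f (xs ++ ys) ≈ total f xs + total f ys
    total-++ f []       ys = sym (+-identityˡ _)
    total-++ f (x ∷ xs) ys = trans (+-congˡ (total-++ f xs ys)) (sym (+-assoc _ _ _))

    total-map : ∀ {B : Set} (f : A → Carrier) (g : B → A) xs → total f (map g xs) ≡ total (f ∘ g) xs
    total-map f g []       = ≡.refl
    total-map f g (x ∷ xs) = ≡.cong (f (g x) +_) (total-map f g xs)

    total-cong : ∀ {f g : A → Carrier} xs → (∀ x → x ∈ xs → f x ≈ g x) → total f xs ≈ total g xs
    total-cong []       eq = refl
    total-cong (x ∷ xs) eq = +-cong (eq x (here ≡.refl)) (total-cong xs λ y y∈ → eq y (there y∈))

    total-0 : ∀ xs → total {A} (λ _ → 0#) xs ≈ 0#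
    total-0 []       = refl
    total-0 (x ∷ xs) = trans (+-identityˡ _) (total-0 xs)

    total-+ : ∀ (f g : A → Carrier) xs → total (λ x → f x + g x) xs ≈ total f xs + total g xs
    total-+ f g []       = sym (+-identityˡ _)
    total-+ f g (x ∷ xs) = trans (+-congˡ (total-+ f g xs)) (interchange _ _ _ _)

    total-*ˡ : ∀ a (f : A → Carrier) xs → total (λ x → a * f x) xs ≈ a * total f xs
    total-*ˡ a f []       = sym (zeroʳ a)
    total-*ˡ a f (x ∷ xs) = trans (+-congˡ (total-*ˡ a f xs)) (sym (distribˡ _ _ _))

  -- The generating function of the weight `f` over the partitions with parts at most `m`; a length
  -- bound equal to the degree excludes none of them.
  enum : ℕ → (List ℕ → Carrier) → Coefficients
  enum m f n = total f (boundedPartitions n m n)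

  enum-cong′ : ∀ m {f g} → (∀ {n} π → n ≤ N → IsPartition n π → All (_≤ m) π → f π ≈ g π) →
               enum m f ≋ enum m g
  enum-cong′ m eq n n≤N = total-cong (boundedPartitions n m n) λ π π∈ →
    eq π n≤N (proj₁ (boundedPartitions-sound n m n π∈)) (proj₂ (boundedPartitions-sound n m n π∈))

  enum-cong : ∀ m {f g} → (∀ π → All (_≤ m) π → f π ≈ g π) → enum m f ≋ enum m g
  enum-cong m eq = enum-cong′ m λ π _ _ → eq π

  enum-0 : ∀ m {f} → (∀ π → All (_≤ m) π → f π ≈ 0#) → enum m f ≋ 𝟘
  enum-0 m eq n n≤N = trans (enum-cong m eq n n≤N) (total-0 (boundedPartitions n m n))

  enum-* : ∀ m a f → enum m (λ π → a * f π) ≋ const a ⊛ enum m f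
  enum-* m a f n _ = trans (total-*ˡ a f (boundedPartitions n m n)) (sym (const-⊛ a (enum m f) n))

  open BigOperator +-commutativeMonoid using () renaming (big to ∑ᴿ)

  enum-∑ : ∀ m k (f : ℕ → List ℕ → Carrier) → enum m (λ π → ∑ᴿ k (λ i → f i π)) ≋ ∑ k (λ i → enum m (f i))
  enum-∑ m zero    f n _   = total-0 (boundedPartitions n m n)
  enum-∑ m (suc k) f n n≤N = trans (total-+ _ (f k) (boundedPartitions n m n)) (+-congʳ (enum-∑ m k f n n≤N))

  enum-zero : ∀ f → enum 0 f ≋ const (f [])
  enum-zero f zero    _ = +-identityʳ _
  enum-zero f (suc n) _ = refl

  -- Either `suc m` is not a part, or it is the first part, and removing one copy lowers the degree
  -- by `suc m`.
  enum-suc : ∀ m f → enum (suc m) f ≋ enum m f ⊕ X ^ suc m ⊛ enum (suc m) (f ∘ (suc m ∷_))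
  enum-suc m f zero    _ = sym (trans (+-congˡ (X^-⊛-< (suc m) (enum (suc m) (f ∘ (suc m ∷_))) 0 (s≤s z≤n))) (+-identityʳ _))
  enum-suc m f (suc n) _ = trans (total-++ f (boundedPartitions (suc n) m (suc n)) _)
    (+-congˡ (headed (ℕ.≤ᵇ-reflects-≤ m n)))
    where
    g = enum (suc m) (f ∘ (suc m ∷_))
    headed : ∀ {b} → Reflects (m ≤ n) b →
             total f (if b then map (suc m ∷_) (boundedPartitions n (suc m) (n ℕ.∸ m)) else [])
             ≈ (X ^ suc m ⊛ g) (suc n)
    headed (ofⁿ m≰n) = sym (X^-⊛-< (suc m) g (suc n) (s≤s (ℕ.≰⇒> m≰n)))
    headed (ofʸ m≤n) = begin
      total f (map (suc m ∷_) (boundedPartitions n (suc m) (n ℕ.∸ m)))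
        ≡⟨ total-map f (suc m ∷_) (boundedPartitions n (suc m) (n ℕ.∸ m)) ⟩
      total (f ∘ (suc m ∷_)) (boundedPartitions n (suc m) (n ℕ.∸ m))
        ≡⟨ ≡.cong (total (f ∘ (suc m ∷_))) (boundedPartitions-fuel (suc m) (ℕ.m∸n≤m n m) ℕ.≤-refl) ⟩
      g (n ℕ.∸ m)
        ≈⟨ X^-⊛-≥ (suc m) g (n ℕ.∸ m) ⟨
      (X ^ suc m ⊛ g) (suc m ℕ.+ (n ℕ.∸ m))
        ≡⟨ ≡.cong (λ k → (X ^ suc m ⊛ g) (suc k)) (ℕ.m+[n∸m]≡n m≤n) ⟩
      (X ^ suc m ⊛ g) (suc n)
        ∎

  X^suc-nilpotent : ∀ m → Nilpotent (X ^ suc m)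
  X^suc-nilpotent m = nilpotent-*ʳ (X ^ m) X^-nilpotent

  enum-never : ∀ m {f} → (∀ π → f (suc m ∷ π) ≈ 0#) → enum (suc m) f ≋ enum m f
  enum-never m {f} f≈0 = S.trans (enum-suc m f)
    (S.trans (S.+-congˡ (S.trans (S.*-congˡ (enum-0 (suc m) λ π _ → f≈0 π)) (S.zeroʳ _))) (S.+-identityʳ _))

  -- With each copy of `suc m` contributing a factor `a`, `enum-suc` becomes an equation of the kind
  -- that `γ-unique` solves.
  enum-free : ∀ m {f} a → (∀ π → f (suc m ∷ π) ≈ a * f π) →
              enum (suc m) f ≋ γ (const a ⊛ X ^ suc m) ⊛ enum m f
  enum-free m {f} a eq = γ-unique (nilpotent-*ˡ (const a) (X^suc-nilpotent m))
    (S.trans (enum-suc m f) (S.+-congˡ (S.trans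
      (S.*-congˡ (S.trans (enum-cong (suc m) λ π _ → eq π) (enum-* (suc m) a f)))
      (S.trans (S.sym (S.*-assoc _ _ _)) (S.*-congʳ (S.*-comm _ _))))))

  enum-free₁ : ∀ m {f} → (∀ π → f (suc m ∷ π) ≈ f π) → enum (suc m) f ≋ γ (X ^ suc m) ⊛ enum m f
  enum-free₁ m eq = S.trans (enum-free m 1# λ π → trans (eq π) (sym (*-identityˡ _)))
    (S.*-congʳ (γ-cong (S.*-identityˡ _)))

  enum-atMostOnce : ∀ m {f} → (∀ π → f (suc m ∷ suc m ∷ π) ≈ 0#) →
                    (∀ π → All (_≤ m) π → f (suc m ∷ π) ≈ f π) →
                    enum (suc m) f ≋ (const 1# ⊕ X ^ suc m) ⊛ enum m f
  enum-atMostOnce m {f} twice once = S.trans (enum-suc m f) (S.trans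
    (S.+-cong (S.sym (S.*-identityˡ _)) (S.*-congˡ (S.trans (enum-never m twice) (enum-cong m once))))
    (S.sym (S.distribʳ _ _ _)))

  -- The first copy of `suc m` is forced and accounts for `X ^ suc m`; further copies are free and
  -- account for the geometric series.
  enum-atLeastOnce : ∀ m {f} → (∀ π → All (_≤ m) π → f π ≈ 0#) →
                     (∀ π → f (suc m ∷ suc m ∷ π) ≈ f (suc m ∷ π)) →
                     enum (suc m) f ≋ γ (X ^ suc m) ⊛ (X ^ suc m ⊛ enum m (f ∘ (suc m ∷_)))
  enum-atLeastOnce m {f} none twice = S.trans (enum-suc m f) (S.trans
    (S.+-cong (enum-0 m none) (S.*-congˡ (enum-free₁ m twice)))
    (S.trans (S.+-identityˡ _)
      (S.trans (S.sym (S.*-assoc _ _ _)) (S.trans (S.*-congʳ (S.*-comm _ _)) (S.*-assoc _ _ _)))))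

-- Parity, staircases of even parts, and the meex

even-*2 : ∀ i → Even (i ℕ.* 2)
even-*2 i = divides i ≡.refl

even⇒odd-suc : ∀ {n} → Even n → Odd (suc n)
even⇒odd-suc {n} en en+1 = contradiction
  (∣1⇒≡1 (∣m+n∣m⇒∣n (≡.subst Even (ℕ.+-comm 1 n) en+1) en)) λ ()

odd-suc-*2 : ∀ i → Odd (suc (i ℕ.* 2))
odd-suc-*2 i = even⇒odd-suc (even-*2 i)

noOddPartRepeated-even : ∀ {x π} → Even x → NoOddPartRepeated (x ∷ π) ⇔ NoOddPartRepeated π
noOddPartRepeated-even {x} {π} ex = mk⇔ (≡.subst (AllPairs _≢_) eq) (≡.subst (AllPairs _≢_) (≡.sym eq))
  where
  eq : filter odd? (x ∷ π) ≡ filter odd? π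
  eq = filter-reject odd? λ ox → ox ex

noOddPartRepeated-odd : ∀ {m π} → Odd (suc m) → All (_≤ m) π →
                        NoOddPartRepeated (suc m ∷ π) ⇔ NoOddPartRepeated π
noOddPartRepeated-odd {m} {π} ox ≤m = mk⇔
  (λ u → AllPairs.tail (≡.subst (AllPairs _≢_) eq u))
  (λ u → ≡.subst (AllPairs _≢_) (≡.sym eq) (filter⁺ odd? (All.map (λ y≤m → λ { ≡.refl → ℕ.1+n≰n y≤m }) ≤m) ∷ u))
  where
  eq : filter odd? (suc m ∷ π) ≡ suc m ∷ filter odd? π
  eq = filter-accept odd? ox

oddPartRepeated : ∀ {x π} → Odd x → ¬ NoOddPartRepeated (x ∷ x ∷ π)
oddPartRepeated {x} {π} ox u with ≡.subst (AllPairs _≢_)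
  (≡.trans (filter-accept odd? ox) (≡.cong (x ∷_) (filter-accept odd? ox))) u
... | (x≢x ∷ _) ∷ _ = x≢x ≡.refl

-- All of 2, 4, up to `2k` are parts. The meex is `2k + 2` when moreover `2k + 2` is not a part.
Staircase : ℕ → List ℕ → Set
Staircase zero    π = ⊤
Staircase (suc k) π = suc k ℕ.* 2 ∈ π × Staircase k π

staircase? : ∀ k π → Dec (Staircase k π)
staircase? zero    π = yes tt
staircase? (suc k) π = (suc k ℕ.* 2 ∈? π) ×-dec staircase? k π

staircase-∈ : ∀ {k i π} → i ℕ.< k → Staircase k π → suc i ℕ.* 2 ∈ π
staircase-∈ {suc k} {i} i<1+k (k∈ , st) with i ℕ.≟ k
... | yes ≡.refl = k∈
... | no i≢k     = staircase-∈ (ℕ.≤∧≢⇒< (ℕ.m<1+n⇒m≤n i<1+k) i≢k) st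

∈-staircase : ∀ k {π} → (∀ i → i ℕ.< k → suc i ℕ.* 2 ∈ π) → Staircase k π
∈-staircase zero    ∈π = tt
∈-staircase (suc k) ∈π = ∈π k ℕ.≤-refl , ∈-staircase k λ i i<k → ∈π i (ℕ.m<n⇒m<1+n i<k)

∈-drop : ∀ {x y : ℕ} {π} → x ≢ y → x ∈ y ∷ π → x ∈ π
∈-drop x≢y (here x≡y) = contradiction x≡y x≢y
∈-drop x≢y (there x∈) = x∈

staircase-∷ : ∀ k {x π} → (∀ i → i ℕ.< k → suc i ℕ.* 2 ≢ x) → Staircase k (x ∷ π) ⇔ Staircase k π
staircase-∷ k ≢x = mk⇔
  (λ st → ∈-staircase k λ i i<k → ∈-drop (≢x i i<k) (staircase-∈ i<k st))
  (λ st → ∈-staircase k λ i i<k → there (staircase-∈ i<k st))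

staircase-odd : ∀ k {x π} → Odd x → Staircase k (x ∷ π) ⇔ Staircase k π
staircase-odd k ox = staircase-∷ k λ { i _ ≡.refl → ox (even-*2 (suc i)) }

staircase-above : ∀ k {x π} → k ℕ.* 2 ℕ.< x → Staircase k (x ∷ π) ⇔ Staircase k π
staircase-above k 2k<x = staircase-∷ k λ { i i<k ≡.refl → ℕ.<⇒≱ 2k<x (ℕ.*-monoˡ-≤ 2 i<k) }

-- The threshold is an argument of its own, so that it stays fixed while parts are put in front of
-- the partition.
evenPartsAbove : ℕ → List ℕ → ℕ
evenPartsAbove m π = length (filter (λ k → even? k ×-dec (m ℕ.<? k)) π)

evenPartsAbove-reject : ∀ {m x π} → ¬ (Even x × m ℕ.< x) → evenPartsAbove m (x ∷ π) ≡ evenPartsAbove m π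
evenPartsAbove-reject {m} ¬p = ≡.cong length (filter-reject (λ k → even? k ×-dec (m ℕ.<? k)) ¬p)

evenPartsAbove-accept : ∀ {m x π} → Even x → m ℕ.< x → evenPartsAbove m (x ∷ π) ≡ suc (evenPartsAbove m π)
evenPartsAbove-accept {m} ex m<x = ≡.cong length (filter-accept (λ k → even? k ×-dec (m ℕ.<? k)) (ex , m<x))

evenPartsAbove-none : ∀ {m π} → All (_≤ m) π → evenPartsAbove m π ≡ 0
evenPartsAbove-none []         = ≡.refl
evenPartsAbove-none (x≤m ∷ ≤m) =
  ≡.trans (evenPartsAbove-reject λ (_ , m<x) → ℕ.<⇒≱ m<x x≤m) (evenPartsAbove-none ≤m)

WithMeex : ℕ → List ℕ → Set
WithMeex k π = NoOddPartRepeated π × Staircase k π × (suc k ℕ.* 2 ∉ π)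

withMeex? : ∀ k π → Dec (WithMeex k π)
withMeex? k π = noOddPartRepeated? π ×-dec (staircase? k π ×-dec ¬? (suc k ℕ.* 2 ∈? π))

-- The bound `k ≤ n` ensures that a finite sum over `k` meets every possible meex.
meex-index : ∀ {n} π → IsPartition n π →
             ∃ λ k → k ≤ n × meex π ≡ suc k ℕ.* 2 × Staircase k π × (suc k ℕ.* 2 ∉ π)
meex-index {n} π (isPartition _ _ ≡.refl) with meex π | meex-correct π
... | _ | record { positive = () ; even = divides zero ≡.refl }
... | _ | record { even = divides (suc k) ≡.refl ; missing = missing ; least = least } =
  k , k≤n , ≡.refl , ∈-staircase k present , missing
  where
  k≤n : k ≤ n
  -- The even number `suc n * 2` exceeds the total `n`, so it is not a part and bounds the meex.
  k≤n = ℕ.≤-pred (ℕ.*-cancelʳ-≤ (suc k) (suc n) 2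
    (least (suc n ℕ.* 2) (s≤s z≤n) (even-*2 (suc n))
      λ ∈π → ℕ.1+n≰n (ℕ.≤-trans (ℕ.m≤m*n (suc n) 2) (∈⇒≤sum ∈π))))
  present : ∀ i → i ℕ.< k → suc i ℕ.* 2 ∈ π
  present i i<k with suc i ℕ.* 2 ∈? π
  ... | yes ∈π = ∈π
  ... | no ∉π  = contradiction (ℕ.*-cancelʳ-≤ (suc k) (suc i) 2 (least _ (s≤s z≤n) (even-*2 (suc i)) ∉π)) (ℕ.<⇒≱ (s≤s i<k))

staircase-unique : ∀ {i k π} → Staircase i π → suc i ℕ.* 2 ∉ π → Staircase k π → suc k ℕ.* 2 ∉ π → i ≡ k
staircase-unique {i} {k} si i∉ sk k∉ = ℕ.≤-antisym
  (ℕ.≮⇒≥ λ k<i → k∉ (staircase-∈ k<i si)) (ℕ.≮⇒≥ λ i<k → i∉ (staircase-∈ i<k sk))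

evenPartsMultiplesOf4-∷ : ∀ {x π} → (Even x → 4 ∣ x) →
                          EvenPartsMultiplesOf4 (x ∷ π) ⇔ EvenPartsMultiplesOf4 π
evenPartsMultiplesOf4-∷ px = mk⇔ All.tail (px ∷_)

2+4i-not-4∣ : ∀ i → ¬ (4 ∣ 2 ℕ.+ i ℕ.* 4)
2+4i-not-4∣ i 4∣ with ∣m+n∣m⇒∣n (≡.subst (4 ∣_) (ℕ.+-comm 2 (i ℕ.* 4)) 4∣) (divides i ≡.refl)
... | divides (suc _) ()

_×-⇔_ : ∀ {A B C D : Set} → A ⇔ B → C ⇔ D → (A × C) ⇔ (B × D)
A⇔B ×-⇔ C⇔D = mk⇔ (Product.map (to A⇔B) (to C⇔D)) (Product.map (from A⇔B) (from C⇔D))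
  where open Equivalence

infixr 2 _×-⇔_

-- The two generating functions

module GeneratingFunctions {c ℓ : Level} (R : CommutativeSemiring c ℓ)
                           (z : CommutativeSemiring.Carrier R) (N : ℕ) where

  open CommutativeSemiring R
  open Enumeration R N
  open Series R N renaming (_^_ to _^ˢ_)
  private module S = CommutativeSemiring commutativeSemiring
  open Geometric commutativeSemiring N hiding (_^_)
  open Euler commutativeSemiring N
  open import Algebra.Properties.Semiring.Exp semiring using (_^_)
  open BigOperator +-commutativeMonoid using () renaming (big to ∑ᴿ; big-ε to ∑ᴿ-0)
  open import Relation.Binary.Reasoning.Setoid S.setoid
  open import Algebra.Solver.Ring.NaturalCoefficients.Default commutativeSemiring using (solve; _:=_; _:*_; con)

  weight : {P : Set} → Dec P → ℕ → Carrier
  weight (yes _) e = z ^ e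
  weight (no _)  e = 0#

  weight-⇔ : ∀ {P Q : Set} (P? : Dec P) (Q? : Dec Q) {d e} → P ⇔ Q → d ≡ e → weight P? d ≈ weight Q? e
  weight-⇔ (yes _) (yes _) _   ≡.refl = refl
  weight-⇔ (no _)  (no _)  _   _      = refl
  weight-⇔ (yes p) (no ¬q) P⇔Q _      = contradiction (Equivalence.to P⇔Q p) ¬q
  weight-⇔ (no ¬p) (yes q) P⇔Q _      = contradiction (Equivalence.from P⇔Q q) ¬p

  weight-¬ : ∀ {P : Set} (P? : Dec P) {e} → ¬ P → weight P? e ≈ 0#
  weight-¬ (yes p) ¬p = contradiction p ¬p
  weight-¬ (no _)  _  = refl

  weight-suc : ∀ {P : Set} (P? : Dec P) e → weight P? (suc e) ≈ z * weight P? e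
  weight-suc (yes _) e = refl
  weight-suc (no _)  e = sym (zeroʳ z)

  Q ζ : Coefficients
  Q = X ⊛ X
  ζ = const z

  Q-nilpotent : Nilpotent Q
  Q-nilpotent = nilpotent-*ˡ X X^-nilpotent

  open Lebesgue commutativeSemiring N Q Q-nilpotent

  -- Accounts for distinct odd parts below `2n`.
  odds : ℕ → Coefficients
  odds n = ∏ n λ i → S.1# ⊕ X ⊛ Q ^ˢ i

  staircaseWeight : ℕ → List ℕ → Carrier
  staircaseWeight k π = weight (noOddPartRepeated? π ×-dec staircase? k π) 0

  meexWeight : ℕ → List ℕ → Carrier
  meexWeight k π = weight (withMeex? k π) (evenPartsAbove (suc k ℕ.* 2) π)

  enum-odd : ∀ i {f} → (∀ {x} π → Odd x → f (x ∷ x ∷ π) ≈ 0#) →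
             (∀ {m} π → Odd (suc m) → All (_≤ m) π → f (suc m ∷ π) ≈ f π) →
             enum (suc (i ℕ.* 2)) f ≋ (S.1# ⊕ X ⊛ Q ^ˢ i) ⊛ enum (i ℕ.* 2) f
  enum-odd i twice once = S.trans
    (enum-atMostOnce (i ℕ.* 2) (λ π → twice π (odd-suc-*2 i)) (λ π → once π (odd-suc-*2 i)))
    (S.*-congʳ (S.+-congˡ (S.*-congˡ (S.sym (square-^ X i)))))

  -- Each even part `2i` with `1 ≤ i ≤ k` occurs at least once and contributes `Q^i / (1 - Q^i)`.
  -- Together these factors make `t k`, and the distinct odd parts make `odds k`.
  enum-staircase : ∀ k → enum (k ℕ.* 2) (staircaseWeight k) ≋ odds k ⊛ t k
  enum-staircase zero    = S.trans (enum-zero (staircaseWeight 0)) (S.sym (S.*-identityˡ _))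
  enum-staircase (suc k) = begin
    enum (suc k ℕ.* 2) (staircaseWeight (suc k))
      ≈⟨ enum-atLeastOnce (suc (k ℕ.* 2))
           (λ π ≤m → weight-¬ (noOddPartRepeated? π ×-dec staircase? (suc k) π)
              λ (_ , k∈ , _) → ℕ.1+n≰n (All.lookup ≤m k∈))
           (λ π → weight-⇔ (noOddPartRepeated? (top ∷ top ∷ π) ×-dec staircase? (suc k) (top ∷ top ∷ π))
              (noOddPartRepeated? (top ∷ π) ×-dec staircase? (suc k) (top ∷ π))
              (noOddPartRepeated-even (even-*2 (suc k)) ×-⇔ extra π) ≡.refl) ⟩
    γ (X ^ˢ top) ⊛ (X ^ˢ top ⊛ enum (suc (k ℕ.* 2)) (staircaseWeight (suc k) ∘ (top ∷_)))
      ≈⟨ S.*-cong (γ-cong (S.sym (square-^ X (suc k)))) (S.*-cong (S.sym (square-^ X (suc k)))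
           (S.trans (enum-cong (suc (k ℕ.* 2)) λ π _ →
              weight-⇔ (noOddPartRepeated? (top ∷ π) ×-dec staircase? (suc k) (top ∷ π))
                (noOddPartRepeated? π ×-dec staircase? k π)
                (noOddPartRepeated-even (even-*2 (suc k)) ×-⇔ removed π) ≡.refl)
              (S.trans (enum-odd k
                (λ {x} π ox → weight-¬ (noOddPartRepeated? (x ∷ x ∷ π) ×-dec staircase? k (x ∷ x ∷ π))
                   (oddPartRepeated ox ∘ proj₁))
                (λ {m} π ox ≤m → weight-⇔ (noOddPartRepeated? (suc m ∷ π) ×-dec staircase? k (suc m ∷ π))
                   (noOddPartRepeated? π ×-dec staircase? k π)
                   (noOddPartRepeated-odd ox ≤m ×-⇔ staircase-odd k ox) ≡.refl))
              (S.*-congˡ (enum-staircase k))))) ⟩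
    γ (Q ^ˢ suc k) ⊛ (Q ^ˢ suc k ⊛ ((S.1# ⊕ X ⊛ Q ^ˢ k) ⊛ (odds k ⊛ t k)))
      ≈⟨ solve 5 (λ g p f o s → g :* (p :* (f :* (o :* s))) := o :* f :* (g :* (p :* s))) S.refl
           (γ (Q ^ˢ suc k)) (Q ^ˢ suc k) (S.1# ⊕ X ⊛ Q ^ˢ k) (odds k) (t k) ⟩
    odds (suc k) ⊛ t (suc k)
      ∎
    where
    top = suc k ℕ.* 2
    removed : ∀ π → Staircase (suc k) (top ∷ π) ⇔ Staircase k π
    removed π = mk⇔ (to ∘ proj₂) (λ st → here ≡.refl , from st)
      where open Equivalence (staircase-above k {top} {π} (s≤s (ℕ.n≤1+n _)))
    extra : ∀ π → Staircase (suc k) (top ∷ top ∷ π) ⇔ Staircase (suc k) (top ∷ π)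
    extra π = mk⇔ (λ (_ , st) → here ≡.refl , to st) (λ (_ , st) → here ≡.refl , from st)
      where open Equivalence (staircase-above k {top} {top ∷ π} (s≤s (ℕ.n≤1+n _)))

  -- Induction on `d`, two part sizes at a time. The staircase gives `t k`, the part `2k + 2` is
  -- forbidden, and each larger even size contributes a geometric series in which `z` marks every
  -- copy.
  enum-meex : ∀ k d → enum ((suc k ℕ.+ d) ℕ.* 2) (meexWeight k) ≋
              odds (suc k ℕ.+ d) ⊛ (t k ⊛ 1/[ ζ ⊛ Q ^ˢ (2 ℕ.+ k) ] d)
  enum-meex k = go
    where
    top = suc k ℕ.* 2

    ∉-∷ : ∀ {x π} → top ≢ x → top ∉ x ∷ π ⇔ top ∉ π
    ∉-∷ top≢x = mk⇔ (λ ∉∷ → ∉∷ ∘ there) (λ ∉π → ∉π ∘ ∈-drop top≢x)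

    odd-level : ∀ i → enum (suc (i ℕ.* 2)) (meexWeight k) ≋ (S.1# ⊕ X ⊛ Q ^ˢ i) ⊛ enum (i ℕ.* 2) (meexWeight k)
    odd-level i = enum-odd i
      (λ {x} π ox → weight-¬ (withMeex? k (x ∷ x ∷ π)) (oddPartRepeated ox ∘ proj₁))
      (λ {m} π ox ≤m → weight-⇔ (withMeex? k (suc m ∷ π)) (withMeex? k π)
         (noOddPartRepeated-odd ox ≤m ×-⇔ staircase-odd k ox ×-⇔ ∉-∷ λ { ≡.refl → ox (even-*2 (suc k)) })
         (evenPartsAbove-reject (ox ∘ proj₁)))

    even-level : ∀ d → let m = (suc k ℕ.+ d) ℕ.* 2 in
                 ∀ π → meexWeight k (2 ℕ.+ m ∷ π) ≈ z * meexWeight k π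
    even-level d π = trans
      (weight-⇔ (withMeex? k (x ∷ π)) (withMeex? k π)
        (noOddPartRepeated-even ex ×-⇔ staircase-above k (ℕ.<-trans (s≤s (ℕ.n≤1+n _)) top<x) ×-⇔ ∉-∷ (ℕ.<⇒≢ top<x))
        (evenPartsAbove-accept ex top<x))
      (weight-suc (withMeex? k π) _)
      where
      x = suc (suc k ℕ.+ d) ℕ.* 2
      ex = even-*2 (suc (suc k ℕ.+ d))
      top<x : top ℕ.< x
      top<x = ℕ.*-monoˡ-< 2 (s≤s (ℕ.m≤m+n (suc k) d))

    go : ∀ d → enum ((suc k ℕ.+ d) ℕ.* 2) (meexWeight k) ≋
         odds (suc k ℕ.+ d) ⊛ (t k ⊛ 1/[ ζ ⊛ Q ^ˢ (2 ℕ.+ k) ] d)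
    go zero rewrite ℕ.+-identityʳ k = begin
      enum top (meexWeight k)
        ≈⟨ enum-never (suc (k ℕ.* 2)) (λ π → weight-¬ (withMeex? k (top ∷ π)) λ (_ , _ , ∉) → ∉ (here ≡.refl)) ⟩
      enum (suc (k ℕ.* 2)) (meexWeight k)
        ≈⟨ odd-level k ⟩
      (S.1# ⊕ X ⊛ Q ^ˢ k) ⊛ enum (k ℕ.* 2) (meexWeight k)
        ≈⟨ S.*-congˡ (S.trans (enum-cong (k ℕ.* 2) below) (enum-staircase k)) ⟩
      (S.1# ⊕ X ⊛ Q ^ˢ k) ⊛ (odds k ⊛ t k)
        ≈⟨ solve 3 (λ f o s → f :* (o :* s) := o :* f :* (s :* con 1)) S.refl (S.1# ⊕ X ⊛ Q ^ˢ k) (odds k) (t k) ⟩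
      odds (suc k) ⊛ (t k ⊛ S.1#)
        ∎
      where
      -- When all parts are at most `2k`, the part `2k + 2` is automatically missing and the
      -- exponent of `z` is 0.
      below : ∀ π → All (_≤ k ℕ.* 2) π → meexWeight k π ≈ staircaseWeight k π
      below π ≤2k = weight-⇔ (withMeex? k π) (noOddPartRepeated? π ×-dec staircase? k π)
        (mk⇔ (λ (u , st , _) → u , st) (λ (u , st) → u , st , λ ∈π → ℕ.<⇒≱ (s≤s (ℕ.n≤1+n _)) (All.lookup ≤2k ∈π)))
        (evenPartsAbove-none (All.map (λ ≤2k → ℕ.≤-trans ≤2k (ℕ.m≤n+m _ 2)) ≤2k))
    go (suc d) rewrite ℕ.+-suc k d = begin
      enum (2 ℕ.+ m) (meexWeight k)
        ≈⟨ enum-free (suc m) z (even-level d) ⟩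
      γ (ζ ⊛ X ^ˢ (2 ℕ.+ m)) ⊛ enum (suc m) (meexWeight k)
        ≈⟨ S.*-cong (γ-cong power) (S.trans (odd-level (suc k ℕ.+ d)) (S.*-congˡ (go d))) ⟩
      γ (ζ ⊛ Q ^ˢ (2 ℕ.+ k) ⊛ Q ^ˢ d) ⊛ (f ⊛ (odds (suc k ℕ.+ d) ⊛ (t k ⊛ 1/[ ζ ⊛ Q ^ˢ (2 ℕ.+ k) ] d)))
        ≈⟨ solve 5 (λ g f o s p → g :* (f :* (o :* (s :* p))) := o :* f :* (s :* (p :* g))) S.refl
             (γ (ζ ⊛ Q ^ˢ (2 ℕ.+ k) ⊛ Q ^ˢ d)) f (odds (suc k ℕ.+ d)) (t k) (1/[ ζ ⊛ Q ^ˢ (2 ℕ.+ k) ] d) ⟩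
      odds (2 ℕ.+ k ℕ.+ d) ⊛ (t k ⊛ 1/[ ζ ⊛ Q ^ˢ (2 ℕ.+ k) ] (suc d))
        ∎
      where
      m = (suc k ℕ.+ d) ℕ.* 2
      f = S.1# ⊕ X ⊛ Q ^ˢ (suc k ℕ.+ d)
      power : ζ ⊛ X ^ˢ (2 ℕ.+ m) ≋ ζ ⊛ Q ^ˢ (2 ℕ.+ k) ⊛ Q ^ˢ d
      power = S.trans (S.*-congˡ (S.trans (S.sym (square-^ X (2 ℕ.+ k ℕ.+ d))) (^-homo-* Q (2 ℕ.+ k) d)))
        (S.sym (S.*-assoc _ _ _))

  odWeight : List ℕ → Carrier
  odWeight π = weight (noOddPartRepeated? π) (evenPartsAboveMeex π)

  ∑-single : ∀ n {k f} → k ℕ.< n → (∀ i → i ≢ k → f i ≈ 0#) → ∑ᴿ n f ≈ f k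
  ∑-single (suc n) {k} {f} k<1+n f≈0 with k ℕ.≟ n
  ... | yes ≡.refl = trans (+-congʳ (∑ᴿ-0 n λ i i<n → f≈0 i (ℕ.<⇒≢ i<n))) (+-identityˡ _)
  ... | no k≢n     = trans (+-cong (∑-single n (ℕ.≤∧≢⇒< (ℕ.m<1+n⇒m≤n k<1+n) k≢n) f≈0)
                              (f≈0 n (k≢n ∘ ≡.sym))) (+-identityʳ _)

  -- Sorting by the meex: exactly one index contributes, and it is at most `n`, hence below `K`.
  odWeight-∑ : ∀ {n} π → n ≤ N → IsPartition n π → odWeight π ≈ ∑ᴿ K (λ k → meexWeight k π)
  odWeight-∑ π n≤N part with meex-index π part
  ... | k , k≤n , meex≡ , st , ∉π = trans
    (weight-⇔ (noOddPartRepeated? π) (withMeex? k π) (mk⇔ (λ u → u , st , ∉π) proj₁)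
      (≡.cong (λ m → evenPartsAbove m π) meex≡))
    (sym (∑-single K (s≤s (ℕ.≤-trans k≤n n≤N)) λ i i≢k → weight-¬ (withMeex? i π)
      λ (_ , st′ , ∉′) → i≢k (staircase-unique st′ ∉′ st ∉π)))

  multiplesOf4 : Coefficients
  multiplesOf4 = ∏ K λ i → γ (ζ ⊛ (Q ⊛ Q) ^ˢ suc i)

  enum-od : enum (K ℕ.* 2) odWeight ≋ multiplesOf4 ⊛ odd X
  enum-od = begin
    enum (K ℕ.* 2) odWeight
      ≈⟨ enum-cong′ (K ℕ.* 2) (λ π n≤N part _ → odWeight-∑ π n≤N part) ⟩
    enum (K ℕ.* 2) (λ π → ∑ᴿ K (λ k → meexWeight k π))
      ≈⟨ enum-∑ (K ℕ.* 2) K meexWeight ⟩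
    ∑ K (λ k → enum (K ℕ.* 2) (meexWeight k))
      ≈⟨ ∑-cong K summand ⟩
    ∑ K (λ k → odds K ⊛ (t k ⊛ 1/[ ζ ⊛ Q ^ˢ (2 ℕ.+ k) ]∞))
      ≈⟨ ∑-*ˡ K (odds K) _ ⟩
    odds K ⊛ F ζ
      ≈⟨ S.*-congˡ (lebesgue ζ) ⟩
    odds K ⊛ (multiplesOf4 ⊛ distinct Q)
      ≈⟨ solve 3 (λ o m d → o :* (m :* d) := m :* (o :* d)) S.refl (odds K) multiplesOf4 (distinct Q) ⟩
    multiplesOf4 ⊛ (distinctOdd X ⊛ distinct Q)
      ≈⟨ S.*-congˡ (S.trans (S.sym (distinct-split X^-nilpotent)) (distinct≈odd X^-nilpotent)) ⟩
    multiplesOf4 ⊛ odd X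
      ∎
    where
    summand : ∀ k → k ℕ.< K → enum (K ℕ.* 2) (meexWeight k) ≋ odds K ⊛ (t k ⊛ 1/[ ζ ⊛ Q ^ˢ (2 ℕ.+ k) ]∞)
    summand k k<K = begin
      enum (K ℕ.* 2) (meexWeight k)
        ≡⟨ ≡.cong (λ n → enum (n ℕ.* 2) (meexWeight k)) K≡ ⟨
      enum ((suc k ℕ.+ d) ℕ.* 2) (meexWeight k)
        ≈⟨ enum-meex k d ⟩
      odds (suc k ℕ.+ d) ⊛ (t k ⊛ 1/[ ζ ⊛ Q ^ˢ (2 ℕ.+ k) ] d)
        ≡⟨ ≡.cong (λ n → odds n ⊛ (t k ⊛ 1/[ ζ ⊛ Q ^ˢ (2 ℕ.+ k) ] d)) K≡ ⟩
      odds K ⊛ (t k ⊛ 1/[ ζ ⊛ Q ^ˢ (2 ℕ.+ k) ] d)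
        -- Here `2 + k + d` is `K + 1`, so the finite product has already reached its stable value.
        ≈⟨ S.*-congˡ (S.*-congˡ (1/[]-stable ζ (2 ℕ.+ k) d (ℕ.m≤n⇒m≤1+n (ℕ.≤-reflexive (≡.sym K≡))))) ⟩
      odds K ⊛ (t k ⊛ 1/[ ζ ⊛ Q ^ˢ (2 ℕ.+ k) ]∞)
        ∎
      where
      d = K ℕ.∸ suc k
      K≡ : suc k ℕ.+ d ≡ K
      K≡ = ℕ.m+[n∸m]≡n k<K

  fourWeight : List ℕ → Carrier
  fourWeight π = weight (evenPartsMultiplesOf4? π) (evenParts π)

  fourWeight-odd : ∀ {x} → Odd x → ∀ π → fourWeight (x ∷ π) ≈ fourWeight π
  fourWeight-odd {x} ox π = weight-⇔ (evenPartsMultiplesOf4? (x ∷ π)) (evenPartsMultiplesOf4? π)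
    (evenPartsMultiplesOf4-∷ λ ex → contradiction ex ox) (≡.cong length (filter-reject even? ox))

  fourWeight-4∣ : ∀ {x} → Even x → 4 ∣ x → ∀ π → fourWeight (x ∷ π) ≈ z * fourWeight π
  fourWeight-4∣ {x} ex 4∣x π = trans
    (weight-⇔ (evenPartsMultiplesOf4? (x ∷ π)) (evenPartsMultiplesOf4? π)
      (evenPartsMultiplesOf4-∷ λ _ → 4∣x) (≡.cong length (filter-accept even? ex)))
    (weight-suc (evenPartsMultiplesOf4? π) _)

  fourWeight-4∤ : ∀ {x} → Even x → ¬ (4 ∣ x) → ∀ π → fourWeight (x ∷ π) ≈ 0#
  fourWeight-4∤ {x} ex 4∤x π = weight-¬ (evenPartsMultiplesOf4? (x ∷ π)) λ { (px ∷ _) → 4∤x (px ex) }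

  ^-*4 : ∀ n → Q ^ˢ (n ℕ.* 2) ≋ X ^ˢ (n ℕ.* 4)
  ^-*4 n = S.trans (square-^ X (n ℕ.* 2)) (S.reflexive (≡.cong (X ^ˢ_) (ℕ.*-assoc n 2 2)))

  -- Adds the four part sizes `4n + 1` to `4n + 4` at a time: the two odd sizes are free, `4n + 2`
  -- is excluded, and `4n + 4` is free with each copy marked by `z`.
  enum-four-product : ∀ n → enum (n ℕ.* 4) fourWeight ≋
    ∏ n (λ i → γ (ζ ⊛ (Q ⊛ Q) ^ˢ suc i)) ⊛
    ∏ n (λ i → γ (X ⊛ Q ^ˢ (i ℕ.* 2)) ⊛ γ (X ⊛ Q ^ˢ suc (i ℕ.* 2)))
  enum-four-product zero    = S.trans (enum-zero fourWeight) (S.sym (S.*-identityˡ _))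
  enum-four-product (suc n) = begin
    enum (4 ℕ.+ m) fourWeight
      ≈⟨ enum-free (3 ℕ.+ m) z (fourWeight-4∣ (even₄ (suc n)) (divides (suc n) ≡.refl)) ⟩
    γ (ζ ⊛ X ^ˢ (4 ℕ.+ m)) ⊛ enum (3 ℕ.+ m) fourWeight
      ≈⟨ S.*-cong (γ-cong (S.*-congˡ fourth)) (S.trans
           (enum-free₁ (2 ℕ.+ m) (fourWeight-odd (even⇒odd-suc even₂)))
           (S.*-cong (γ-cong (S.*-congˡ third)) (S.trans
             (enum-never (1 ℕ.+ m) (fourWeight-4∤ even₂ (2+4i-not-4∣ n))) (S.trans
             (enum-free₁ m (fourWeight-odd (even⇒odd-suc (even₄ n))))
             (S.*-cong (γ-cong (S.*-congˡ (S.sym (^-*4 n)))) (enum-four-product n)))))) ⟩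
    g ⊛ (g₃ ⊛ (g₁ ⊛ (a ⊛ b)))
      ≈⟨ solve 5 (λ g g₃ g₁ a b → g :* (g₃ :* (g₁ :* (a :* b))) := a :* g :* (b :* (g₁ :* g₃))) S.refl g g₃ g₁ a b ⟩
    (a ⊛ g) ⊛ (b ⊛ (g₁ ⊛ g₃))
      ∎
    where
    m = n ℕ.* 4
    g  = γ (ζ ⊛ (Q ⊛ Q) ^ˢ suc n)
    g₁ = γ (X ⊛ Q ^ˢ (n ℕ.* 2))
    g₃ = γ (X ⊛ Q ^ˢ suc (n ℕ.* 2))
    a = ∏ n (λ i → γ (ζ ⊛ (Q ⊛ Q) ^ˢ suc i))
    b = ∏ n (λ i → γ (X ⊛ Q ^ˢ (i ℕ.* 2)) ⊛ γ (X ⊛ Q ^ˢ suc (i ℕ.* 2)))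
    even₄ : ∀ n → Even (n ℕ.* 4)
    even₄ n = ∣-trans (divides 2 ≡.refl) (divides n ≡.refl)
    even₂ : Even (2 ℕ.+ m)
    even₂ = ∣m∣n⇒∣m+n ∣-refl (even₄ n)
    third : X ^ˢ (2 ℕ.+ m) ≋ Q ^ˢ suc (n ℕ.* 2)
    third = S.trans (S.sym (S.*-assoc _ _ _)) (S.*-congˡ (S.sym (^-*4 n)))
    fourth : X ^ˢ (suc n ℕ.* 4) ≋ (Q ⊛ Q) ^ˢ suc n
    fourth = S.sym (S.trans (square-^ Q (suc n)) (^-*4 (suc n)))

  enum-four : enum (K ℕ.* 4) fourWeight ≋ multiplesOf4 ⊛ odd X
  enum-four = S.trans (enum-four-product K) (S.*-congˡ (S.trans
    -- Unpairing the odd sizes gives `K * 2` factors, of which those of index at least `K` are 1.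
    (S.sym (∏-double K λ i → γ (X ⊛ Q ^ˢ i)))
    (∏-truncate _ (ℕ.m≤m*n K 2) λ i K≤i → γ-0 (vanish-*^ X K≤i))))

  equidistribution : ∀ n → n ≤ N → total odWeight (partitions n) ≈ total fourWeight (partitions n)
  equidistribution n n≤N =
    trans (reflexive (≡.sym (≡.cong (total odWeight) (boundedPartitions-large n n (n≤K* 2)))))
    (trans (S.trans enum-od (S.sym enum-four) n n≤N)
    (reflexive (≡.cong (total fourWeight) (boundedPartitions-large n n (n≤K* 4)))))
    where
    n≤K* : ∀ m .{{_ : ℕ.NonZero m}} → n ≤ K ℕ.* m
    n≤K* m = ℕ.≤-trans (ℕ.m≤n⇒m≤1+n n≤N) (ℕ.m≤m*n K m)

-- Extraction of the coefficient of the j-th power of z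

module _ (j : ℕ) where

  open Series ℕ.+-*-commutativeSemiring j using (X; _^_; X^-diagonal; X^-off-diagonal; commutativeSemiring)

  -- The weights are themselves truncated series, with `X` in the role of `z`. The coefficient of
  -- degree `j` in `X ^ e` is 1 if `e` equals `j` and 0 otherwise, so the total weight counts the
  -- filtered list.
  coefficient : ∀ N {P : List ℕ → Set} (P? : Decidable P) (e : List ℕ → ℕ) πs →
    let open GeneratingFunctions commutativeSemiring X N using (weight)
        open Enumeration commutativeSemiring N using (total) in
    total (λ π → weight (P? π) (e π)) πs j ≡ length (filter (λ π → P? π ×-dec (e π ℕ.≟ j)) πs)
  coefficient N P? e []       = ≡.refl
  coefficient N P? e (π ∷ πs) with P? π | coefficient N P? e πs
  ... | no _  | ih = ih
  -- The test `e π ≟ j` computes through `≡ᵇ`, so splitting on this Boolean lets the filter reduce.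
  ... | yes _ | ih with e π ℕ.≡ᵇ j | ℕ.≡ᵇ⇒≡ (e π) j | ℕ.≡⇒≡ᵇ (e π) j
  ...   | true  | e≡j | _   = ≡.cong₂ ℕ._+_ (≡.subst (λ i → (X ^ e π) i ≡ 1) (e≡j tt) (X^-diagonal (e π))) ih
  ...   | false | _   | e≢j = ≡.cong₂ ℕ._+_ (X^-off-diagonal e≢j) ih

theorem1p8 : (n j : ℕ) → p-od,e n j ≡ p-4,e n j
theorem1p8 n j = ≡.trans (≡.sym (coefficient j n noOddPartRepeated? evenPartsAboveMeex (partitions n)))
  -- Series in `q` truncated at `n` have series in `z` truncated at `j` as coefficients; both are
  -- read off in their last degree.
  (≡.trans (equidistribution n ℕ.≤-refl j ℕ.≤-refl)
    (coefficient j n evenPartsMultiplesOf4? evenParts (partitions n)))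
  where
  open Series ℕ.+-*-commutativeSemiring j using (X; commutativeSemiring)
  open GeneratingFunctions commutativeSemiring X n using (equidistribution)
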